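{- Let $K_1(n)$ denote the number of partitions of $n$ into parts $\equiv\pm1,\pm18,\pm20$ or $\pm38\pmod{76}$ such that the parts $\equiv\pm1$ and $\pm38\pmod{76}$ have $2$ colors. Let $K_2(n)$ denote the number of partitions of $n$ into parts $\equiv\pm18,\pm20,\pm37$ or $\pm38\pmod{76}$ such that the parts $\equiv\pm37$ and $\pm38\pmod{76}$ have $2$ colors. Let $K_3(n)$ denote the number of partitions of $n$ into parts $\equiv\pm1,\pm19$ and $\pm37\pmod{76}$, each part having $2$ colors. Here $+38$ and $-38$ are counted as two separate residues (although they coincide modulo $76$), so that parts $\equiv 38\pmod{76}$ occur in $4$ colors in total in $K_1$ and in $K_2$. Then for every integer $n\ge18$, $$K_1(n)-K_2(n-18)-K_3(n)=0.$$
   Context: A part in a partition has $r$ colors if there are $r$ copies of each such part, all viewed as distinct objects; parts for which no number of colors is specified have one color. Partitions are unordered, and each of the counting functions equals $1$ at $n=0$. With $(\lambda;q)_\infty=\prod_{j\ge0}(1-\lambda q^j)$, $(\lambda_1,\dots,\lambda_s;q)_\infty=\prod_{j}(\lambda_j;q)_\infty$ and the convention $(q^{r\pm};q^t)_\infty:=(q^r,q^{t-r};q^t)_\infty$ for $0<r<t$ (so $(q^{38\pm};q^{76})_\infty=(q^{38};q^{76})_\infty^2$), and $(q^{r_1\pm},\dots,q^{r_s\pm};q^t)_\infty:=\prod_j (q^{r_j\pm};q^t)_\infty$, the generating functions are $$\sum_{n\ge0}K_1(n)q^n=\frac{1}{(q^{18\pm},q^{20\pm};q^{76})_\infty(q^{1\pm},q^{38\pm};q^{76})_\infty^2},$$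 $$\sum_{n\ge0}K_2(n)q^n=\frac{1}{(q^{18\pm},q^{20\pm};q^{76})_\infty(q^{37\pm},q^{38\pm};q^{76})_\infty^2},$$ $$\sum_{n\ge0}K_3(n)q^n=\frac{1}{(q^{1\pm},q^{19\pm},q^{37\pm};q^{76})_\infty^2}.$$ -}

{-# OPTIONS --safe --termination-depth=2 #-}

module Defs where

open import Data.Bool.Base using (if_then_else_)
open import Data.Empty using (⊥-elim)
open import Data.Fin.Base using (Fin; zero; suc)
open import Data.Integer.Base as ℤ using (ℤ; +_)
open import Data.Integer.Divisibility.Signed using (_∣?_)
open import Data.List.Base using (List; []; _∷_; _++_; map; length; lookup)
open import Data.List.Membership.Propositional using (_∈_)
open import Data.List.Membership.Propositional.Properties
  using (∈-map⁺; ∈-map⁻; ∈-++⁺ˡ; ∈-++⁺ʳ; ∈-++⁻; ∈-lookup)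
open import Data.List.Properties using (∷-injectiveʳ)
open import Data.List.Relation.Binary.Disjoint.Propositional using (Disjoint)
open import Data.List.Relation.Unary.All as All using (All; []; _∷_)
open import Data.List.Relation.Unary.AllPairs using (AllPairs; []; _∷_)
open import Data.List.Relation.Unary.Any using (here; there; index)
open import Data.List.Relation.Unary.Any.Properties using (lookup-index)
open import Data.List.Relation.Unary.Linked as Linked using (Linked)
open import Data.List.Relation.Unary.Linked.Properties using (AllPairs⇒Linked; Linked⇒AllPairs)
open import Data.List.Relation.Unary.Unique.Propositional using (Unique)
import Data.List.Relation.Unary.Unique.Propositional.Properties as Unique
open import Data.Nat.Base using (ℕ; zero; suc; _+_; _∸_; _≤_; _<_; _≥_; _>_; z≤n; s≤s)
open import Data.Nat.ListAction using (sum)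
open import Data.Nat.Properties
open import Data.Product.Base using (_×_; _,_; proj₁; proj₂; ∃)
open import Data.Product.Relation.Binary.Lex.Strict using (×-Lex)
open import Data.Sum.Base using (inj₁; inj₂)
open import Function.Bundles using (_↔_; mk↔ₛ′)
open import Relation.Binary.Core using (Rel)
open import Relation.Binary.Definitions using (Irrelevant; Transitive)
open import Relation.Binary.PropositionalEquality
open import Relation.Nullary.Decidable.Core using (does; yes; no)
open import Relation.Nullary.Negation.Core using (contradiction)

-- A coloured part is a pair (size , colour).  A colouring c gives the number
-- of colours available for each size, the colours of size m being 0 , … , c m ∸ 1.

Part : Set
Part = ℕ × ℕ

Colouring : Set
Colouring = ℕ → ℕ

IsPart : Colouring → Part → Set
IsPart c (m , i) = 0 < m × i < c m

infix 4 _≽_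

_≽_ : Rel Part _
_≽_ = ×-Lex _≡_ _>_ _≥_

-- A partition is a multiset of coloured parts.  Each multiset is represented
-- by its unique listing in lexicographically non-increasing order; comparing
-- colours serves only to make this listing unique.

record Partition (c : Colouring) (n : ℕ) : Set where
  constructor partition
  field
    parts   : List Part
    valid   : All (IsPart c) parts
    ordered : Linked _≽_ parts
    total   : sum (map proj₁ parts) ≡ n

module Enumeration where

  ≽-trans : Transitive _≽_
  ≽-trans (inj₁ p)          (inj₁ q)          = inj₁ (<-trans q p)
  ≽-trans (inj₁ p)          (inj₂ (refl , _)) = inj₁ p
  ≽-trans (inj₂ (refl , _)) (inj₁ q)          = inj₁ q
  ≽-trans (inj₂ (refl , p)) (inj₂ (refl , q)) = inj₂ (refl , ≤-trans q p)

  ≽-irrelevant : Irrelevant _≽_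
  ≽-irrelevant (inj₁ p)       (inj₁ q)       = cong inj₁ (<-irrelevant p q)
  ≽-irrelevant (inj₁ p)       (inj₂ (e , _)) = contradiction (sym e) (<⇒≢ p)
  ≽-irrelevant (inj₂ (e , _)) (inj₁ q)       = contradiction (sym e) (<⇒≢ q)
  ≽-irrelevant (inj₂ (d , p)) (inj₂ (e , q)) =
    cong₂ (λ x y → inj₂ (x , y)) (≡-irrelevant d e) (≤-irrelevant p q)

  IsPart-irrelevant : ∀ {c p} (x y : IsPart c p) → x ≡ y
  IsPart-irrelevant (a , b) (a′ , b′) = cong₂ _,_ (<-irrelevant a a′) (<-irrelevant b b′)

  partition-≡ : ∀ {c n} {π ρ : Partition c n} → Partition.parts π ≡ Partition.parts ρ → π ≡ ρ
  partition-≡ {c} {π = partition ps v o t} {partition .ps v′ o′ t′} refl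
    with refl ← All.irrelevant (IsPart-irrelevant {c}) v v′
       | refl ← Linked.irrelevant ≽-irrelevant o o′
       | refl ← ≡-irrelevant t t′ = refl

  infix 4 _≺_

  _≺_ : Rel Part _
  _≺_ = ×-Lex _≡_ _<_ _<_

  ≼-≺-trans : ∀ {p q r} → p ≽ q → p ≺ r → q ≺ r
  ≼-≺-trans (inj₁ a)          (inj₁ b)          = inj₁ (<-trans a b)
  ≼-≺-trans (inj₁ a)          (inj₂ (refl , _)) = inj₁ a
  ≼-≺-trans (inj₂ (refl , _)) (inj₁ b)          = inj₁ b
  ≼-≺-trans (inj₂ (refl , a)) (inj₂ (refl , b)) = inj₂ (refl , ≤-<-trans a b)

  -- The partitions of n all of whose parts are ≺ (m , j), provided f ≥ n; f is
  -- only there for termination.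
  below : Colouring → (m j f n : ℕ) → List (List Part)
  below c zero    j       f       zero    = [] ∷ []
  below c zero    j       f       (suc n) = []
  below c (suc m) zero    f       n       = below c m (c m) n n
  below c (suc m) (suc j) zero    n       = below c (suc m) j zero n
  below c (suc m) (suc j) (suc f) n with suc m ≤? n
  ... | no  _ = below c (suc m) j (suc f) n
  ... | yes _ = below c (suc m) j (suc f) n
             ++ map ((suc m , j) ∷_) (below c (suc m) (suc j) f (n ∸ suc m))

  record Below (c : Colouring) (m j n : ℕ) (ps : List Part) : Set where
    constructor mkBelow
    field
      valid   : All (IsPart c) ps
      bounded : All (_≺ (m , j)) ps
      ordered : AllPairs _≽_ ps
      total   : sum (map proj₁ ps) ≡ n

  ≺-suc : ∀ {p m j} → p ≺ (m , j) → p ≺ (m , suc j)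
  ≺-suc (inj₁ a)       = inj₁ a
  ≺-suc (inj₂ (e , a)) = inj₂ (e , m<n⇒m<1+n a)

  ≺-step : ∀ {p m j} → p ≺ (m , j) → p ≺ (suc m , 0)
  ≺-step (inj₁ a)          = inj₁ (m<n⇒m<1+n a)
  ≺-step (inj₂ (refl , _)) = inj₁ (n<1+n _)

  ≺-unstep : ∀ {c p m} → IsPart c p → p ≺ (suc m , 0) → p ≺ (m , c m)
  ≺-unstep (_ , b) (inj₁ (s≤s a)) with m≤n⇒m<n∨m≡n a
  ... | inj₁ l    = inj₁ l
  ... | inj₂ refl = inj₂ (refl , b)

  ≺⇒≼ : ∀ {p m j} → p ≺ (m , suc j) → (m , j) ≽ p
  ≺⇒≼ (inj₁ a)             = inj₁ a
  ≺⇒≼ (inj₂ (e , s≤s a)) = inj₂ (sym e , a)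

  sound : ∀ c m j f n → j ≤ c m → ∀ {ps} → ps ∈ below c m j f n → Below c m j n ps
  sound c zero    j       f       zero    h (here refl) = mkBelow [] [] [] refl
  sound c (suc m) zero    f       n       h ps∈ =
    let mkBelow v b o t = sound c m (c m) n n ≤-refl ps∈ in mkBelow v (All.map ≺-step b) o t
  sound c (suc m) (suc j) zero    n       h ps∈ =
    let mkBelow v b o t = sound c (suc m) j zero n (<⇒≤ h) ps∈ in mkBelow v (All.map ≺-suc b) o t
  sound c (suc m) (suc j) (suc f) n h ps∈ with suc m ≤? n
  ... | no _ =
    let mkBelow v b o t = sound c (suc m) j (suc f) n (<⇒≤ h) ps∈ in mkBelow v (All.map ≺-suc b) o t
  ... | yes le with ∈-++⁻ (below c (suc m) j (suc f) n) ps∈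
  ...   | inj₁ ps∈ˡ =
    let mkBelow v b o t = sound c (suc m) j (suc f) n (<⇒≤ h) ps∈ˡ in mkBelow v (All.map ≺-suc b) o t
  ...   | inj₂ ps∈ʳ with ∈-map⁻ ((suc m , j) ∷_) ps∈ʳ
  ...     | qs , qs∈ , refl =
    let mkBelow v b o t = sound c (suc m) (suc j) f (n ∸ suc m) h qs∈ in
    mkBelow ((s≤s z≤n , h) ∷ v) (inj₂ (refl , ≤-refl) ∷ b) (All.map ≺⇒≼ b ∷ o)
            (trans (cong (λ x → suc m + x) t) (m+[n∸m]≡n le))

  lower : ∀ {c m j n p ps} → p ≺ (m , j) → Below c m (suc j) n (p ∷ ps) → Below c m j n (p ∷ ps)
  lower l (mkBelow v _ (a ∷ o) t) = mkBelow v (l ∷ All.map (λ x → ≼-≺-trans x l) a) (a ∷ o) t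

  head-size : ∀ {c m j n p ps} → Below c m j n (p ∷ ps) → proj₁ p ≤ n
  head-size (mkBelow _ _ _ refl) = m≤m+n _ _

  fuel : ∀ {n f m} → n ≤ suc f → n ∸ suc m ≤ f
  fuel {zero}           _       = z≤n
  fuel {suc n} {m = m} (s≤s l) = ≤-trans (m∸n≤m n m) l

  complete : ∀ c m j f n → n ≤ f → ∀ {ps} → Below c m j n ps → ps ∈ below c m j f n
  complete c zero    j       f       zero    l {[]}     _ = here refl
  complete c zero    j       f       (suc n) l {[]}     (mkBelow _ _ _ ())
  complete c zero    j       f       n       l {p ∷ ps} (mkBelow ((pos , _) ∷ _) (inj₂ (refl , _) ∷ _) _ _) =
    ⊥-elim (n≮0 pos)
  complete c (suc m) zero    f       n       l (mkBelow v b o t) =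
    complete c m (c m) n n ≤-refl (mkBelow v (All.zipWith (λ (x , y) → ≺-unstep {c} x y) (v , b)) o t)
  complete c (suc m) (suc j) zero    n       l {[]} (mkBelow v b o t) =
    complete c (suc m) j zero n l (mkBelow [] [] [] t)
  complete c (suc m) (suc j) zero    zero    l {p ∷ ps} B@(mkBelow ((pos , _) ∷ _) _ _ _) =
    ⊥-elim (n≮0 (<-≤-trans pos (head-size B)))
  complete c (suc m) (suc j) (suc f) n l {[]} (mkBelow v b o t) with suc m ≤? n
  ... | no _  = complete c (suc m) j (suc f) n l (mkBelow [] [] [] t)
  ... | yes _ = ∈-++⁺ˡ (complete c (suc m) j (suc f) n l (mkBelow [] [] [] t))
  complete c (suc m) (suc j) (suc f) n l {p ∷ ps} B@(mkBelow (_ ∷ v) (p≺ ∷ b) (_ ∷ o) t)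
    with suc m ≤? n | ≺⇒≼ p≺
  ... | no _   | inj₁ a = complete c (suc m) j (suc f) n l (lower (inj₁ a) B)
  ... | yes _  | inj₁ a = ∈-++⁺ˡ (complete c (suc m) j (suc f) n l (lower (inj₁ a) B))
  ... | no ≰   | inj₂ (refl , _) = contradiction (head-size B) ≰
  ... | yes le | inj₂ (refl , a) with m≤n⇒m<n∨m≡n a
  ...   | inj₁ i<j  = ∈-++⁺ˡ (complete c (suc m) j (suc f) n l (lower (inj₂ (refl , i<j)) B))
  ...   | inj₂ refl = ∈-++⁺ʳ (below c (suc m) j (suc f) n)
    (∈-map⁺ _ (complete c (suc m) (suc j) f (n ∸ suc m) (fuel l)
      (mkBelow v b o (trans (sym (m+n∸m≡n (suc m) _)) (cong (_∸ suc m) t)))))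

  unique : ∀ c m j f n → j ≤ c m → Unique (below c m j f n)
  unique c zero    j       f       zero    h = [] ∷ []
  unique c zero    j       f       (suc n) h = []
  unique c (suc m) zero    f       n       h = unique c m (c m) n n ≤-refl
  unique c (suc m) (suc j) zero    n       h = unique c (suc m) j zero n (<⇒≤ h)
  unique c (suc m) (suc j) (suc f) n h with suc m ≤? n
  ... | no  _ = unique c (suc m) j (suc f) n (<⇒≤ h)
  ... | yes _ = Unique.++⁺ (unique c (suc m) j (suc f) n (<⇒≤ h))
                           (Unique.map⁺ ∷-injectiveʳ (unique c (suc m) (suc j) f (n ∸ suc m) h))
                           disjoint
    where
    disjoint : Disjoint (below c (suc m) j (suc f) n)
                        (map ((suc m , j) ∷_) (below c (suc m) (suc j) f (n ∸ suc m)))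
    disjoint (x∈ , y∈) with ∈-map⁻ ((suc m , j) ∷_) y∈
    ... | _ , _ , refl with Below.bounded (sound c (suc m) j (suc f) n (<⇒≤ h) x∈)
    ...   | inj₁ a       ∷ _ = <-irrefl refl a
    ...   | inj₂ (_ , a) ∷ _ = <-irrefl refl a

  lookup-injective : ∀ {A : Set} {xs : List A} → Unique xs →
                     ∀ {i j} → lookup xs i ≡ lookup xs j → i ≡ j
  lookup-injective (_ ∷ _) {zero}  {zero}  _ = refl
  lookup-injective (x ∷ _) {zero}  {suc j} e = contradiction e (All.lookup x (∈-lookup j))
  lookup-injective (x ∷ _) {suc i} {zero}  e = contradiction (sym e) (All.lookup x (∈-lookup i))
  lookup-injective (_ ∷ u) {suc i} {suc j} e = cong suc (lookup-injective u e)

  parts≤total : (ps : List Part) → All (λ p → proj₁ p ≤ sum (map proj₁ ps)) ps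
  parts≤total []       = []
  parts≤total (p ∷ ps) =
    m≤m+n _ _ ∷ All.map (λ x → ≤-trans x (m≤n+m _ (proj₁ p))) (parts≤total ps)

finite : ∀ c n → ∃ λ k → Fin k ↔ Partition c n
finite c n = length xs , mk↔ₛ′ to from to∘from from∘to
  where
  open Enumeration

  xs = below c (suc n) 0 n n

  to : Fin (length xs) → Partition c n
  to i = let mkBelow v _ o t = sound c (suc n) 0 n n z≤n (∈-lookup {xs = xs} i)
         in partition (lookup xs i) v (AllPairs⇒Linked o) t

  member : (π : Partition c n) → Partition.parts π ∈ xs
  member (partition ps v o t) = complete c (suc n) 0 n n ≤-refl
    (mkBelow v (All.map (λ x → inj₁ (s≤s (≤-trans x (≤-reflexive t)))) (parts≤total ps))
             (Linked⇒AllPairs ≽-trans o) t)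

  from : Partition c n → Fin (length xs)
  from π = index (member π)

  to∘from : ∀ π → to (from π) ≡ π
  to∘from π = partition-≡ (sym (lookup-index (member π)))

  from∘to : ∀ i → from (to i) ≡ i
  from∘to i = lookup-injective (unique c (suc n) 0 n n z≤n) (sym (lookup-index (member (to i))))

#partitions : Colouring → ℕ → ℕ
#partitions c n = proj₁ (finite c n)

-- A list of pairs (a , k), each granting k colours to the parts ≡ a (mod t).
-- Grants accumulate, so listing both 38 and -38 modulo 76 doubles the colours.

colouring : ℕ → List (ℤ × ℕ) → Colouring
colouring t rs m = sum (map (λ (a , k) → if does (+ t ∣? (+ m ℤ.- a)) then k else 0) rs)

± : ℕ → ℕ → List (ℤ × ℕ)
± r k = (+ r , k) ∷ (ℤ.- (+ r) , k) ∷ []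

K₁ K₂ K₃ : ℕ → ℕ
K₁ = #partitions (colouring 76 (± 1 2 ++ ± 18 1 ++ ± 20 1 ++ ± 38 2))
K₂ = #partitions (colouring 76 (± 18 1 ++ ± 20 1 ++ ± 37 2 ++ ± 38 2))
K₃ = #partitions (colouring 76 (± 1 2 ++ ± 19 2 ++ ± 37 2))

{-# OPTIONS --safe #-}

-- Write [a] = (q^(a±); q^76)_∞.  After multiplication by all denominators the
-- claim becomes
--   [37]² [19]² = q^18 [1]² [19]² + [18] [20] [38]²,
-- a case of Weierstrass' three-term relation.  With ϑ(u, v) = (−u, −v, uv; uv)_∞
-- (x here denoting −q and r denoting −q^18) it follows from
--   ϑ(xr², x³r²)² + r ϑ(x³r⁴, x)² = ϑ(r, x²r) ϑ(xr, xr).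
-- Jacobi's triple product ϑ(u, v) = Σ_j u^(j(j+1)/2) v^(j(j−1)/2) turns the right
-- side into a sum over pairs (a , b) of integers; the pairs of equal parity,
-- (m + n , m − n), give the first square, and those of opposite parity,
-- (m + n + 1 , m − n), give the second.
--
-- Everything is computed in ℤ[[q]]/(q^M), where infinite products and bilateral
-- series are finite.

module Submission where

open import Defs
open import Algebra.Bundles using (CommutativeMonoid; CommutativeRing)
open import Data.Bool.Base using (if_then_else_)
import Data.Integer.Base as ℤ
open ℤ using (ℤ; +_; -[1+_]; _⊖_; ∣_∣)
open import Data.Integer.Divisibility.Signed using (_∣_; _∣?_; ∣-refl; ∣m∣n⇒∣m+n; ∣m+n∣m⇒∣n)
import Data.Integer.Properties as ℤ
open import Data.Integer.Tactic.RingSolver using () renaming (solve-∀ to ℤ-solve-∀)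
open import Data.List.Base using (List; []; _∷_; _++_; map; length; foldr; replicate; concatMap; applyUpTo)
open import Data.List.Properties using (length-map; length-++)
open import Data.Nat.Base using (ℕ; zero; suc; _≤_; _∸_)
import Data.Nat.Base as ℕ
import Data.Nat.Properties as ℕ
open import Data.Nat.Tactic.RingSolver using () renaming (solve-∀ to ℕ-solve-∀)
open import Data.Product.Base using (_,_)
open import Function.Bundles using (mk⇔)
open import Level using (0ℓ)
import Relation.Binary.PropositionalEquality as ≡
open import Relation.Binary.PropositionalEquality using (_≡_)
open import Relation.Nullary.Decidable using (does-⇔)
open import Relation.Nullary.Decidable.Core using (yes; no)
open import Relation.Nullary.Negation.Core using (contradiction)

-- Iterated operations

-- Under the specialisation x^a r^b becomes (-1)^(a+b) q^(a+18b). On the left the arguments then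
-- have exponents 37, 39 and 75, 1 with base x⁴r⁴ = q^76. On the right they have 18, 20 and 19, 19
-- with base x²r² = q^38, and splitting each product of base q^38 into two of base q^76 gives [18]
-- [20]. The last theta comes out with the wrong sign, as (-q^19; q^38)². This is the origin of the
-- factor [19]²: since (q^19; q^38)(-q^19; q^38) = (q^38; q^76), it leaves (q^38; q^76) to the
-- fourth power, which is [38]² and matches the four colours of the parts ≡ 38. A truncated ring has
-- zero divisors, so nothing may be cancelled merely because it is nonzero. Reciprocals enter as
-- equations E · K = 1, and the common factor (q^76; q^76)² is removed with an inverse of its own.
-- The analytic part holds in any commutative ring with nilpotent q. Its price is bookkeeping: L
-- bounds the nilpotency and the supports, N the number of factors and the summation window, and a
-- change of index is sound only if N is large compared with L.

module BigOp {c ℓ} (M : CommutativeMonoid c ℓ) where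
  open CommutativeMonoid M
  open import Relation.Binary.Reasoning.Setoid setoid
  open import Algebra.Properties.CommutativeSemigroup commutativeSemigroup using (interchange)

  ⨁ : ℕ → (ℕ → Carrier) → Carrier
  ⨁ zero    f = ε
  ⨁ (suc n) f = f 0 ∙ ⨁ n (λ i → f (suc i))

  ⨁-cong : ∀ n {f g} → (∀ i → f i ≈ g i) → ⨁ n f ≈ ⨁ n g
  ⨁-cong zero    h = refl
  ⨁-cong (suc n) h = ∙-cong (h 0) (⨁-cong n λ i → h (suc i))

  ⨁-ε : ∀ n {f} → (∀ i → f i ≈ ε) → ⨁ n f ≈ ε
  ⨁-ε zero    h = refl
  ⨁-ε (suc n) h = trans (∙-cong (h 0) (⨁-ε n λ i → h (suc i))) (identityˡ ε)

  ⨁-∙ : ∀ n f g → ⨁ n (λ i → f i ∙ g i) ≈ ⨁ n f ∙ ⨁ n g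
  ⨁-∙ zero    f g = sym (identityˡ ε)
  ⨁-∙ (suc n) f g = trans (∙-congˡ (⨁-∙ n _ _)) (interchange _ _ _ _)

  ⨁-last : ∀ n f → ⨁ (suc n) f ≈ ⨁ n f ∙ f n
  ⨁-last zero    f = comm _ _
  ⨁-last (suc n) f = trans (∙-congˡ (⨁-last n _)) (sym (assoc _ _ _))

  ⨁-split : ∀ m n f → ⨁ (m ℕ.+ n) f ≈ ⨁ m f ∙ ⨁ n (λ i → f (m ℕ.+ i))
  ⨁-split zero    n f = sym (identityˡ _)
  ⨁-split (suc m) n f = trans (∙-congˡ (⨁-split m n _)) (sym (assoc _ _ _))

  ⨁-extend : ∀ m n f → (∀ i → f (m ℕ.+ i) ≈ ε) → ⨁ (m ℕ.+ n) f ≈ ⨁ m f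
  ⨁-extend m n f h = trans (⨁-split m n f) (trans (∙-congˡ (⨁-ε n h)) (identityʳ _))

  ⨁-blocks : ∀ n d f → ⨁ (n ℕ.* d) f ≈ ⨁ n (λ i → ⨁ d (λ k → f (k ℕ.+ i ℕ.* d)))
  ⨁-blocks zero    d f = refl
  ⨁-blocks (suc n) d f = begin
    ⨁ (d ℕ.+ n ℕ.* d) f                                              ≈⟨ ⨁-split d _ f ⟩
    ⨁ d f ∙ ⨁ (n ℕ.* d) (λ i → f (d ℕ.+ i))                          ≈⟨ ∙-cong
        (⨁-cong d λ k → reflexive (≡.cong f (≡.sym (ℕ.+-identityʳ k))))
        (trans (⨁-blocks n d _) (⨁-cong n λ i → ⨁-cong d λ k → reflexive (≡.cong f (shift k i)))) ⟩
    ⨁ (suc n) (λ i → ⨁ d (λ k → f (k ℕ.+ i ℕ.* d)))                  ∎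
    where
    shift : ∀ k i → d ℕ.+ (k ℕ.+ i ℕ.* d) ≡ k ℕ.+ suc i ℕ.* d
    shift k i = ≡.trans (≡.sym (ℕ.+-assoc d k _))
      (≡.trans (≡.cong (ℕ._+ i ℕ.* d) (ℕ.+-comm d k)) (ℕ.+-assoc k d _))

  ⨁-pairs : ∀ n f → ⨁ (n ℕ.* 2) f ≈ ⨁ n (λ i → f (i ℕ.* 2) ∙ f (suc (i ℕ.* 2)))
  ⨁-pairs n f = trans (⨁-blocks n 2 f) (⨁-cong n λ i → ∙-congˡ (identityʳ _))

  ⨁-swap : ∀ m n (f : ℕ → ℕ → Carrier) → ⨁ m (λ i → ⨁ n (f i)) ≈ ⨁ n (λ j → ⨁ m (λ i → f i j))
  ⨁-swap zero    n f = sym (⨁-ε n λ _ → refl)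
  ⨁-swap (suc m) n f = trans (∙-congˡ (⨁-swap m n _)) (sym (⨁-∙ n _ _))

-- Triangular numbers

triangular : ℕ → ℕ
triangular zero    = zero
triangular (suc n) = suc n ℕ.+ triangular n

-- This is j(j+1)/2 on all integers, a natural number on both sides: for j = -(n+1) it equals
-- n(n+1)/2. Hence `tri (- j)` is j(j-1)/2.
tri : ℤ → ℕ
tri (+ n)    = triangular n
tri -[1+ n ] = triangular n

2*triangular : ∀ n → + 2 ℤ.* + triangular n ≡ + n ℤ.* + n ℤ.+ + n
2*triangular zero    = ≡.refl
2*triangular (suc n) = begin
  + 2 ℤ.* (+ 1 ℤ.+ + n ℤ.+ + triangular n)          ≡⟨ ℤ.*-distribˡ-+ (+ 2) (+ 1 ℤ.+ + n) (+ triangular n) ⟩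
  + 2 ℤ.* (+ 1 ℤ.+ + n) ℤ.+ + 2 ℤ.* + triangular n  ≡⟨ ≡.cong (λ z → + 2 ℤ.* (+ 1 ℤ.+ + n) ℤ.+ z) (2*triangular n) ⟩
  + 2 ℤ.* (+ 1 ℤ.+ + n) ℤ.+ (+ n ℤ.* + n ℤ.+ + n)   ≡⟨ step (+ n) ⟩
  (+ 1 ℤ.+ + n) ℤ.* (+ 1 ℤ.+ + n) ℤ.+ (+ 1 ℤ.+ + n) ∎
  where
  open ≡.≡-Reasoning
  step : ∀ k → + 2 ℤ.* (+ 1 ℤ.+ k) ℤ.+ (k ℤ.* k ℤ.+ k) ≡ (+ 1 ℤ.+ k) ℤ.* (+ 1 ℤ.+ k) ℤ.+ (+ 1 ℤ.+ k)
  step = ℤ-solve-∀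

2*tri : ∀ j → + 2 ℤ.* + tri j ≡ j ℤ.* j ℤ.+ j
2*tri (+ n)    = 2*triangular n
2*tri -[1+ n ] = ≡.trans (2*triangular n) (step (+ n))
  where
  step : ∀ k → k ℤ.* k ℤ.+ k ≡ (ℤ.- (+ 1 ℤ.+ k)) ℤ.* (ℤ.- (+ 1 ℤ.+ k)) ℤ.+ (ℤ.- (+ 1 ℤ.+ k))
  step = ℤ-solve-∀

2*tri- : ∀ j → + 2 ℤ.* + tri (ℤ.- j) ≡ j ℤ.* j ℤ.- j
2*tri- j = ≡.trans (2*tri (ℤ.- j)) (step j)
  where
  step : ∀ k → (ℤ.- k) ℤ.* (ℤ.- k) ℤ.+ (ℤ.- k) ≡ k ℤ.* k ℤ.- k
  step = ℤ-solve-∀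

n≤triangular : ∀ n → n ℕ.≤ triangular n
n≤triangular zero    = ℕ.z≤n
n≤triangular (suc n) = ℕ.m≤m+n (suc n) _

-- n is half of the integer i.  Linear combinations of triangular numbers are
-- compared after doubling, where they become polynomials in the indices.
record Half (n : ℕ) (i : ℤ) : Set where
  constructor half
  field doubled : + 2 ℤ.* + n ≡ i

half-unique : ∀ {m n i j} → Half m i → i ≡ j → Half n j → m ≡ n
half-unique {m} {n} (half p) e (half q) =
  ℤ.+-injective (ℤ.*-cancelˡ-≡ (+ 2) (+ m) (+ n) (≡.trans p (≡.trans e (≡.sym q))))

half-+ : ∀ {m n i j} → Half m i → Half n j → Half (m ℕ.+ n) (i ℤ.+ j)
half-+ {m} {n} (half p) (half q) =
  half (≡.trans (ℤ.*-distribˡ-+ (+ 2) (+ m) (+ n)) (≡.cong₂ ℤ._+_ p q))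

half-* : ∀ {n i} k → Half n i → Half (k ℕ.* n) (+ k ℤ.* i)
half-* {n} zero    (half p) = half ≡.refl
half-* {n} {i} (suc k) h with half q ← half-+ h (half-* k h) =
  half (≡.trans q (step (+ k) i))
  where
  step : ∀ k i → i ℤ.+ k ℤ.* i ≡ (+ 1 ℤ.+ k) ℤ.* i
  step = ℤ-solve-∀

half-2* : ∀ n → Half n (+ 2 ℤ.* + n)
half-2* n = half ≡.refl

half-tri : ∀ {i j} → i ≡ j → Half (tri i) (j ℤ.* j ℤ.+ j)
half-tri {i} ≡.refl = half (2*tri i)

half-tri- : ∀ {i j} → i ≡ j → Half (tri (ℤ.- i)) (j ℤ.* j ℤ.- j)
half-tri- {i} ≡.refl = half (2*tri- i)

⊖≡- : ∀ m n → m ⊖ n ≡ + m ℤ.- + n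
⊖≡- m n = ≡.sym (ℤ.[+m]-[+n]≡m⊖n m n)

-- The exponents of u and v in v · (uv)ⁿ · w (k − n) = (uv)ᵏ · w (k − n − 1),
-- where w j = u^(tri j) v^(tri (− j)).
tri-shift : ∀ n k → tri (k ⊖ n) ℕ.+ n ≡ tri (k ⊖ suc n) ℕ.+ k
tri-shift n k = half-unique
  (half-+ (half-tri (⊖≡- k n)) (half-2* n)) (step (+ n) (+ k))
  (half-+ (half-tri (⊖≡- k (suc n))) (half-2* k))
  where
  step : ∀ n k → (k ℤ.- n) ℤ.* (k ℤ.- n) ℤ.+ (k ℤ.- n) ℤ.+ + 2 ℤ.* n ≡
    (k ℤ.- (+ 1 ℤ.+ n)) ℤ.* (k ℤ.- (+ 1 ℤ.+ n)) ℤ.+ (k ℤ.- (+ 1 ℤ.+ n)) ℤ.+ + 2 ℤ.* k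
  step = ℤ-solve-∀

tri-shift- : ∀ n k → tri (ℤ.- (k ⊖ n)) ℕ.+ suc n ≡ tri (ℤ.- (k ⊖ suc n)) ℕ.+ k
tri-shift- n k = half-unique
  (half-+ (half-tri- (⊖≡- k n)) (half-2* (suc n))) (step (+ n) (+ k))
  (half-+ (half-tri- (⊖≡- k (suc n))) (half-2* k))
  where
  step : ∀ n k → (k ℤ.- n) ℤ.* (k ℤ.- n) ℤ.- (k ℤ.- n) ℤ.+ + 2 ℤ.* (+ 1 ℤ.+ n) ≡
    (k ℤ.- (+ 1 ℤ.+ n)) ℤ.* (k ℤ.- (+ 1 ℤ.+ n)) ℤ.- (k ℤ.- (+ 1 ℤ.+ n)) ℤ.+ + 2 ℤ.* k
  step = ℤ-solve-∀

-- Bilateral sums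

∣i+j∣≥ : ∀ {L} i j → L ℕ.+ ∣ j ∣ ℕ.≤ ∣ i ∣ → L ℕ.≤ ∣ i ℤ.+ j ∣
∣i+j∣≥ {L} i j h = ℕ.+-cancelʳ-≤ (∣ j ∣) L _ (ℕ.≤-trans h (begin
  ∣ i ∣                     ≡⟨ ≡.cong ∣_∣ (cancel i j) ⟨
  ∣ i ℤ.+ j ℤ.- j ∣         ≤⟨ ℤ.∣i-j∣≤∣i∣+∣j∣ (i ℤ.+ j) j ⟩
  ∣ i ℤ.+ j ∣ ℕ.+ ∣ j ∣     ∎))
  where
  open ℕ.≤-Reasoning
  cancel : ∀ i j → i ℤ.+ j ℤ.- j ≡ i
  cancel = ℤ-solve-∀

n*2⊖n : ∀ n → n ℕ.* 2 ⊖ n ≡ + n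
n*2⊖n n = ≡.trans (⊖≡- (n ℕ.* 2) n) (≡.trans (≡.cong (ℤ._- + n) (ℤ.pos-* n 2)) (cancel (+ n)))
  where
  cancel : ∀ i → i ℤ.* + 2 ℤ.- i ≡ i
  cancel = ℤ-solve-∀

*2⊖*2 : ∀ i n → i ℕ.* 2 ⊖ n ℕ.* 2 ≡ (i ⊖ n) ℤ.+ (i ⊖ n)
*2⊖*2 i n = ≡.trans (⊖≡- (i ℕ.* 2) (n ℕ.* 2)) (≡.trans
  (≡.cong₂ ℤ._-_ (ℤ.pos-* i 2) (ℤ.pos-* n 2)) (≡.trans (step (+ i) (+ n))
  (≡.cong (λ z → z ℤ.+ z) (≡.sym (⊖≡- i n)))))
  where
  step : ∀ i n → i ℤ.* + 2 ℤ.- n ℤ.* + 2 ≡ (i ℤ.- n) ℤ.+ (i ℤ.- n)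
  step = ℤ-solve-∀

suc-⊖ : ∀ m n → suc m ⊖ n ≡ (m ⊖ n) ℤ.+ + 1
suc-⊖ m n = ≡.trans (≡.cong (_⊖ n) (ℕ.+-comm 1 m)) (≡.sym (ℤ.distribˡ-⊖-+-pos 1 m n))

module BilateralOp {c ℓ} (M : CommutativeMonoid c ℓ) where
  open CommutativeMonoid M
  open import Relation.Binary.Reasoning.Setoid setoid
  open BigOp M

  -- The window -N ≤ j < N is half-open, so that the window for 2N splits exactly into the pairs 2j,
  -- 2j + 1 with j in the window for N.
  ⨁ℤ : ℕ → (ℤ → Carrier) → Carrier
  ⨁ℤ N f = ⨁ (N ℕ.* 2) (λ i → f (i ⊖ N))

  Supported : ℕ → (ℤ → Carrier) → Set ℓ
  Supported L f = ∀ j → L ℕ.≤ ∣ j ∣ → f j ≈ ε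

  ⨁ℤ-cong : ∀ N {f g} → (∀ j → f j ≈ g j) → ⨁ℤ N f ≈ ⨁ℤ N g
  ⨁ℤ-cong N h = ⨁-cong (N ℕ.* 2) λ i → h (i ⊖ N)

  ⨁ℤ-ε : ∀ N {f} → (∀ j → f j ≈ ε) → ⨁ℤ N f ≈ ε
  ⨁ℤ-ε N h = ⨁-ε (N ℕ.* 2) λ i → h (i ⊖ N)

  ⨁ℤ-∙ : ∀ N f g → ⨁ℤ N (λ j → f j ∙ g j) ≈ ⨁ℤ N f ∙ ⨁ℤ N g
  ⨁ℤ-∙ N f g = ⨁-∙ (N ℕ.* 2) _ _

  ⨁ℤ-swap : ∀ M N (f : ℤ → ℤ → Carrier) →
            ⨁ℤ M (λ i → ⨁ℤ N (f i)) ≈ ⨁ℤ N (λ j → ⨁ℤ M (λ i → f i j))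
  ⨁ℤ-swap M N f = ⨁-swap (M ℕ.* 2) (N ℕ.* 2) _

  ⨁ℤ-pairs : ∀ N f → ⨁ℤ (N ℕ.* 2) f ≈ ⨁ℤ N (λ j → f (j ℤ.+ j) ∙ f (j ℤ.+ j ℤ.+ + 1))
  ⨁ℤ-pairs N f = trans (⨁-pairs (N ℕ.* 2) _) (⨁-cong (N ℕ.* 2) λ i → ∙-cong
    (reflexive (≡.cong f (*2⊖*2 i N)))
    (reflexive (≡.cong f (≡.trans (suc-⊖ (i ℕ.* 2) (N ℕ.* 2)) (≡.cong (ℤ._+ + 1) (*2⊖*2 i N))))))

  ⨁ℤ-widen₁ : ∀ N f → Supported N f → ⨁ℤ (suc N) f ≈ ⨁ℤ N f
  ⨁ℤ-widen₁ N f s = begin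
    f -[1+ N ] ∙ ⨁ (suc (N ℕ.* 2)) (λ i → f (suc i ⊖ suc N))  ≈⟨ ∙-congʳ (s _ (ℕ.n≤1+n N)) ⟩
    ε ∙ ⨁ (suc (N ℕ.* 2)) (λ i → f (suc i ⊖ suc N))           ≈⟨ identityˡ _ ⟩
    ⨁ (suc (N ℕ.* 2)) (λ i → f (suc i ⊖ suc N))               ≈⟨ ⨁-cong (suc (N ℕ.* 2)) (λ i →
                                                                   reflexive (≡.cong f (ℤ.[1+m]⊖[1+n]≡m⊖n i N))) ⟩
    ⨁ (suc (N ℕ.* 2)) (λ i → f (i ⊖ N))                       ≈⟨ ⨁-last (N ℕ.* 2) _ ⟩
    ⨁ℤ N f ∙ f (N ℕ.* 2 ⊖ N)                                  ≈⟨ ∙-congˡ (s _ (ℕ.≤-reflexive (≡.cong ∣_∣ (≡.sym (n*2⊖n N))))) ⟩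
    ⨁ℤ N f ∙ ε                                                ≈⟨ identityʳ _ ⟩
    ⨁ℤ N f                                                    ∎

  ⨁ℤ-widen : ∀ k N f → Supported N f → ⨁ℤ (k ℕ.+ N) f ≈ ⨁ℤ N f
  ⨁ℤ-widen zero    N f s = refl
  ⨁ℤ-widen (suc k) N f s =
    trans (⨁ℤ-widen₁ (k ℕ.+ N) f λ j h → s j (ℕ.≤-trans (ℕ.m≤n+m N k) h)) (⨁ℤ-widen k N f s)

  -- Only the ends change: index -N leaves the window and N enters, and both lie outside the
  -- support.
  ⨁ℤ-shift₁ : ∀ N f → Supported N f → ⨁ℤ N (λ j → f (j ℤ.+ + 1)) ≈ ⨁ℤ N f
  ⨁ℤ-shift₁ N f s = begin
    ⨁ (N ℕ.* 2) (λ i → f ((i ⊖ N) ℤ.+ + 1))        ≈⟨ ⨁-cong (N ℕ.* 2) (λ i → reflexive (≡.cong f (≡.sym (suc-⊖ i N)))) ⟩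
    ⨁ (N ℕ.* 2) (λ i → f (suc i ⊖ N))              ≈⟨ identityˡ _ ⟨
    ε ∙ ⨁ (N ℕ.* 2) (λ i → f (suc i ⊖ N))          ≈⟨ ∙-congʳ (s _ (ℕ.≤-reflexive (≡.sym (ℤ.∣⊖∣-≤ (ℕ.z≤n {N}))))) ⟨
    ⨁ (suc (N ℕ.* 2)) (λ i → f (i ⊖ N))            ≈⟨ ⨁-last (N ℕ.* 2) _ ⟩
    ⨁ℤ N f ∙ f (N ℕ.* 2 ⊖ N)                       ≈⟨ ∙-congˡ (s _ (ℕ.≤-reflexive (≡.cong ∣_∣ (≡.sym (n*2⊖n N))))) ⟩
    ⨁ℤ N f ∙ ε                                     ≈⟨ identityʳ _ ⟩
    ⨁ℤ N f                                         ∎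

  Supported-shift : ∀ {L f} t → Supported L f → Supported (L ℕ.+ ∣ t ∣) (λ j → f (j ℤ.+ t))
  Supported-shift t s j h = s _ (∣i+j∣≥ j t h)

  Supported-≤ : ∀ {L N f} → L ℕ.≤ N → Supported L f → Supported N f
  Supported-≤ L≤N s j h = s j (ℕ.≤-trans L≤N h)

  ⨁ℤ-shift⁺ : ∀ {L} N f k → Supported L f → L ℕ.+ k ℕ.≤ N → ⨁ℤ N (λ j → f (j ℤ.+ + k)) ≈ ⨁ℤ N f
  ⨁ℤ-shift⁺ N f zero s h = ⨁ℤ-cong N λ j → reflexive (≡.cong f (ℤ.+-identityʳ j))
  ⨁ℤ-shift⁺ {L} N f (suc k) s h = begin
    ⨁ℤ N (λ j → f (j ℤ.+ + suc k))             ≈⟨ ⨁ℤ-cong N (λ j → reflexive (≡.cong f (≡.sym (ℤ.+-assoc j (+ 1) (+ k))))) ⟩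
    ⨁ℤ N (λ j → f (j ℤ.+ + 1 ℤ.+ + k))         ≈⟨ ⨁ℤ-shift₁ N _ (Supported-≤ L+k≤N (Supported-shift (+ k) s)) ⟩
    ⨁ℤ N (λ j → f (j ℤ.+ + k))                 ≈⟨ ⨁ℤ-shift⁺ N f k s L+k≤N ⟩
    ⨁ℤ N f                                     ∎
    where
    L+k≤N : L ℕ.+ k ℕ.≤ N
    L+k≤N = ℕ.≤-trans (ℕ.+-monoʳ-≤ L (ℕ.n≤1+n k)) h

  -- A negative shift is undone by a positive one applied to the shifted function. That function has
  -- support radius L + |t|, which is why |t| enters the bound twice.
  ⨁ℤ-shift : ∀ {L} N f t → Supported L f → L ℕ.+ ∣ t ∣ ℕ.+ ∣ t ∣ ℕ.≤ N →
             ⨁ℤ N (λ j → f (j ℤ.+ t)) ≈ ⨁ℤ N f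
  ⨁ℤ-shift N f (+ k)    s h = ⨁ℤ-shift⁺ N f k s (ℕ.≤-trans (ℕ.m≤m+n _ k) h)
  ⨁ℤ-shift N f -[1+ k ] s h = begin
    ⨁ℤ N (λ j → f (j ℤ.+ -[1+ k ]))                   ≈⟨ ⨁ℤ-shift⁺ N _ (suc k) (Supported-shift -[1+ k ] s) h ⟨
    ⨁ℤ N (λ j → f (j ℤ.+ + suc k ℤ.+ -[1+ k ]))       ≈⟨ ⨁ℤ-cong N (λ j → reflexive (≡.cong f (cancel j (+ suc k)))) ⟩
    ⨁ℤ N f                                            ∎
    where
    cancel : ∀ j t → j ℤ.+ t ℤ.+ ℤ.- t ≡ j
    cancel = ℤ-solve-∀

  -- The shift t grows with the outer index i, so no single window would serve all i. But both sides
  -- vanish once |i| ≥ L, and for smaller i the shift is at most L, so that 3L suffices.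
  ⨁ℤ-shift-box : ∀ {L} N (F : ℤ → ℤ → Carrier) i t →
                 (∀ i j → L ℕ.≤ ∣ i ∣ → F i j ≈ ε) → (∀ i → Supported L (F i)) →
                 ∣ t ∣ ℕ.≤ suc ∣ i ∣ → L ℕ.* 3 ℕ.≤ N →
                 ⨁ℤ N (λ j → F i (j ℤ.+ t)) ≈ ⨁ℤ N (F i)
  ⨁ℤ-shift-box {L} N F i t s s′ ∣t∣≤ h with L ℕ.≤? ∣ i ∣
  ... | yes L≤∣i∣ = trans (⨁ℤ-ε N λ j → s i (j ℤ.+ t) L≤∣i∣) (sym (⨁ℤ-ε N λ j → s i j L≤∣i∣))
  ... | no  L≰∣i∣ = ⨁ℤ-shift N (F i) t (s′ i) (ℕ.≤-trans (ℕ.≤-trans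
    (ℕ.+-mono-≤ (ℕ.+-monoʳ-≤ L ∣t∣≤L) ∣t∣≤L) (ℕ.≤-reflexive (≡.trans (ℕ.+-assoc L L L) (≡.sym
      (≡.trans (ℕ.*-comm L 3) (≡.cong (λ z → L ℕ.+ (L ℕ.+ z)) (ℕ.+-identityʳ L))))))) h)
    where
    ∣t∣≤L : ∣ t ∣ ℕ.≤ L
    ∣t∣≤L = ℕ.≤-trans ∣t∣≤ (ℕ.≰⇒> L≰∣i∣)

  -- The pairs (a , b) of equal parity are (m + n , m − n), those of opposite
  -- parity are (m + n + 1 , m − n).
  ⨁ℤ-parity : ∀ {L} N (g : ℤ → ℤ → Carrier) → L ℕ.* 2 ℕ.≤ N →
    let even m n = g (m ℤ.+ n) (m ℤ.- n); odd m n = g (m ℤ.+ n ℤ.+ + 1) (m ℤ.- n) in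
    (∀ a b → L ℕ.≤ ∣ a ∣ → g a b ≈ ε) → (∀ a → Supported L (g a)) →
    (∀ m n → L ℕ.≤ ∣ m ∣ → even m n ≈ ε) → (∀ m → Supported L (even m)) →
    (∀ m n → L ℕ.≤ ∣ m ∣ → odd m n ≈ ε) → (∀ m → Supported L (odd m)) →
    ⨁ℤ (N ℕ.* 2) (λ a → ⨁ℤ (N ℕ.* 2) (g a)) ≈
    ⨁ℤ N (λ m → ⨁ℤ N (even m)) ∙ ⨁ℤ N (λ m → ⨁ℤ N (odd m))
  ⨁ℤ-parity {L} N g h g₁ g₂ e₁ e₂ o₁ o₂ = begin
    ⨁ℤ 2N (λ a → ⨁ℤ 2N (g a))
      -- After b is replaced by b - a, the inner index is the sum of the original pair, and its
      -- parity can be split off.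
      ≈⟨ ⨁ℤ-cong 2N (λ a → ⨁ℤ-shift-box 2N g a (ℤ.- a) g₁ g₂ (∣-a∣≤ a) 3L≤2N) ⟨
    ⨁ℤ 2N (λ a → ⨁ℤ 2N (λ b → g a (b ℤ.- a)))
      ≈⟨ ⨁ℤ-cong 2N (λ a → ⨁ℤ-pairs N (λ b → g a (b ℤ.- a))) ⟩
    ⨁ℤ 2N (λ a → ⨁ℤ N (λ m → even′ m a ∙ odd′ m a))
      ≈⟨ ⨁ℤ-swap 2N N (λ a m → even′ m a ∙ odd′ m a) ⟩
    ⨁ℤ N (λ m → ⨁ℤ 2N (λ a → even′ m a ∙ odd′ m a))
      ≈⟨ ⨁ℤ-cong N (λ m → ⨁ℤ-∙ 2N (even′ m) (odd′ m)) ⟩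
    ⨁ℤ N (λ m → ⨁ℤ 2N (even′ m) ∙ ⨁ℤ 2N (odd′ m))
      ≈⟨ ⨁ℤ-∙ N (λ m → ⨁ℤ 2N (even′ m)) (λ m → ⨁ℤ 2N (odd′ m)) ⟩
    ⨁ℤ N (λ m → ⨁ℤ 2N (even′ m)) ∙
    ⨁ℤ N (λ m → ⨁ℤ 2N (odd′ m))
      -- With the sum of the pair fixed at 2m or 2m + 1, the sum over a is recentred at n = a - m or
      -- n = a - m - 1. The extra 1 is why `⨁ℤ-shift-box` allows a shift up to |i| + 1.
      ≈⟨ ∙-cong
         (⨁ℤ-cong N λ m → trans
           (⨁ℤ-cong 2N λ a → reflexive (≡.cong₂ g (even-fst m a) (even-snd m a)))
           (trans (⨁ℤ-shift-box 2N even m (ℤ.- m) e₁ e₂ (∣-a∣≤ m) 3L≤2N) (narrow (e₂ m))))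
         (⨁ℤ-cong N λ m → trans
           (⨁ℤ-cong 2N λ a → reflexive (≡.cong₂ g (odd-fst m a) (odd-snd m a)))
           (trans (⨁ℤ-shift-box 2N odd m (ℤ.- (m ℤ.+ + 1)) o₁ o₂ (∣-a-1∣≤ m) 3L≤2N) (narrow (o₂ m)))) ⟩
    ⨁ℤ N (λ m → ⨁ℤ N (even m)) ∙ ⨁ℤ N (λ m → ⨁ℤ N (odd m)) ∎
    where
    2N : ℕ
    2N = N ℕ.* 2

    even odd : ℤ → ℤ → Carrier
    even m n = g (m ℤ.+ n) (m ℤ.- n)
    odd  m n = g (m ℤ.+ n ℤ.+ + 1) (m ℤ.- n)

    even′ odd′ : ℤ → ℤ → Carrier
    even′ m a = g a (m ℤ.+ m ℤ.- a)
    odd′  m a = g a (m ℤ.+ m ℤ.+ + 1 ℤ.- a)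

    L≤N : L ℕ.≤ N
    L≤N = ℕ.≤-trans (ℕ.m≤m*n L 2) h

    3L≤2N : L ℕ.* 3 ℕ.≤ 2N
    3L≤2N = ℕ.≤-trans (ℕ.*-monoʳ-≤ L (ℕ.n≤1+n 3))
      (ℕ.≤-trans (ℕ.≤-reflexive (≡.sym (ℕ.*-assoc L 2 2))) (ℕ.*-monoˡ-≤ 2 h))

    ∣-a∣≤ : ∀ a → ∣ ℤ.- a ∣ ℕ.≤ suc ∣ a ∣
    ∣-a∣≤ a = ℕ.≤-trans (ℕ.≤-reflexive (ℤ.∣-i∣≡∣i∣ a)) (ℕ.n≤1+n _)

    ∣-a-1∣≤ : ∀ a → ∣ ℤ.- (a ℤ.+ + 1) ∣ ℕ.≤ suc ∣ a ∣
    ∣-a-1∣≤ a = ℕ.≤-trans (ℕ.≤-reflexive (ℤ.∣-i∣≡∣i∣ (a ℤ.+ + 1)))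
      (ℕ.≤-trans (ℤ.∣i+j∣≤∣i∣+∣j∣ a (+ 1)) (ℕ.≤-reflexive (ℕ.+-comm ∣ a ∣ 1)))

    narrow : ∀ {f} → Supported L f → ⨁ℤ 2N f ≈ ⨁ℤ N f
    narrow {f} s = trans
      (reflexive (≡.cong (λ n → ⨁ℤ n f) (≡.trans (ℕ.*-comm N 2) (≡.cong (N ℕ.+_) (ℕ.+-identityʳ N)))))
      (⨁ℤ-widen N N f (Supported-≤ L≤N s))

    even-fst : ∀ m a → a ≡ m ℤ.+ (a ℤ.+ ℤ.- m)
    even-fst = ℤ-solve-∀
    even-snd : ∀ m a → m ℤ.+ m ℤ.- a ≡ m ℤ.- (a ℤ.+ ℤ.- m)
    even-snd = ℤ-solve-∀
    odd-fst : ∀ m a → a ≡ m ℤ.+ (a ℤ.+ ℤ.- (m ℤ.+ + 1)) ℤ.+ + 1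
    odd-fst = ℤ-solve-∀
    odd-snd : ∀ m a → m ℤ.+ m ℤ.+ + 1 ℤ.- a ≡ m ℤ.- (a ℤ.+ ℤ.- (m ℤ.+ + 1))
    odd-snd = ℤ-solve-∀

-- Jacobi's triple product

module RingLemmas {c ℓ} (R : CommutativeRing c ℓ) where
  open CommutativeRing R
  open import Relation.Binary.Reasoning.Setoid setoid
  open import Algebra.Properties.Semiring.Exp semiring
  open import Algebra.Properties.CommutativeSemiring.Exp commutativeSemiring using (^-distrib-*)
  open import Algebra.Properties.Ring ring using (-0#≈0#)
  open import Algebra.Solver.Ring.NaturalCoefficients.Default commutativeSemiring
    using (solve; _:=_; _:+_; _:*_; con)
  open BigOp *-commutativeMonoid public using () renaming
    ( ⨁ to ∏; ⨁-cong to ∏-cong; ⨁-ε to ∏-1; ⨁-∙ to ∏-*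
    ; ⨁-last to ∏-last; ⨁-extend to ∏-extend; ⨁-pairs to ∏-pairs; ⨁-blocks to ∏-blocks)
  open BigOp +-commutativeMonoid public using () renaming
    (⨁ to ∑; ⨁-cong to ∑-cong; ⨁-ε to ∑-0; ⨁-∙ to ∑-+; ⨁-last to ∑-last)
  open BilateralOp +-commutativeMonoid public using () renaming
    (⨁ℤ to ∑ℤ; ⨁ℤ-cong to ∑ℤ-cong; ⨁ℤ-parity to ∑ℤ-parity; Supported to Supportedℤ)

  ∑-distribˡ : ∀ n a f → a * ∑ n f ≈ ∑ n (λ i → a * f i)
  ∑-distribˡ zero    a f = zeroʳ a
  ∑-distribˡ (suc n) a f = trans (distribˡ a _ _) (+-congˡ (∑-distribˡ n a _))

  ∑-distribʳ : ∀ n a f → ∑ n f * a ≈ ∑ n (λ i → f i * a)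
  ∑-distribʳ n a f = trans (*-comm _ a) (trans (∑-distribˡ n a f) (∑-cong n λ i → *-comm a _))

  ∑ℤ-distribˡ : ∀ n a f → a * ∑ℤ n f ≈ ∑ℤ n (λ i → a * f i)
  ∑ℤ-distribˡ n a f = ∑-distribˡ (n ℕ.* 2) a _

  ∑ℤ-* : ∀ m n f g → ∑ℤ m f * ∑ℤ n g ≈ ∑ℤ m (λ i → ∑ℤ n (λ j → f i * g j))
  ∑ℤ-* m n f g = trans (∑-distribʳ (m ℕ.* 2) (∑ℤ n g) _) (∑-cong (m ℕ.* 2) λ i → ∑ℤ-distribˡ n _ g)

  ^-nilpotent : ∀ {x m n} → x ^ m ≈ 0# → m ℕ.≤ n → x ^ n ≈ 0#
  ^-nilpotent {x} {m} {n} h m≤n = begin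
    x ^ n                        ≈⟨ ^-congʳ x (≡.sym (ℕ.m+[n∸m]≡n m≤n)) ⟩
    x ^ (m ℕ.+ (n ℕ.∸ m))        ≈⟨ ^-homo-* x m _ ⟩
    x ^ m * x ^ (n ℕ.∸ m)        ≈⟨ *-congʳ h ⟩
    0# * x ^ (n ℕ.∸ m)           ≈⟨ zeroˡ _ ⟩
    0#                           ∎

  1-x+x≈1 : ∀ x → 1# - x + x ≈ 1#
  1-x+x≈1 x = trans (+-assoc 1# (- x) x) (trans (+-congˡ (-‿inverseˡ x)) (+-identityʳ 1#))

  1-0≈1 : ∀ {x} → x ≈ 0# → 1# - x ≈ 1#
  1-0≈1 h = trans (+-congˡ (trans (-‿cong h) -0#≈0#)) (+-identityʳ 1#)

  -- Attaching a factor 1 + y adds to a series y times its copy moved up by one index. The last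
  -- hypothesis discards the term pushed past the end of the range.
  ∑-1+ : ∀ n {a b} y → a 0 ≈ b 0 → (∀ k → a (suc k) ≈ b (suc k) + y * b k) → y * b n ≈ 0# →
         ∑ (suc n) a ≈ (1# + y) * ∑ (suc n) b
  ∑-1+ n {a} {b} y a₀ aₛ bₙ = begin
    a 0 + ∑ n (λ k → a (suc k))                        ≈⟨ +-cong a₀ (∑-cong n aₛ) ⟩
    b 0 + ∑ n (λ k → b (suc k) + y * b k)              ≈⟨ +-congˡ (∑-+ n _ _) ⟩
    b 0 + (∑ n (λ k → b (suc k)) + ∑ n (λ k → y * b k)) ≈⟨ +-assoc _ _ _ ⟨
    ∑ (suc n) b + ∑ n (λ k → y * b k)                  ≈⟨ +-cong (*-identityˡ _) lem ⟨
    1# * ∑ (suc n) b + y * ∑ (suc n) b                 ≈⟨ distribʳ _ _ _ ⟨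
    (1# + y) * ∑ (suc n) b                             ∎
    where
    lem : y * ∑ (suc n) b ≈ ∑ n (λ k → y * b k)
    lem = trans (∑-distribˡ (suc n) y b) (trans (∑-last n _) (trans (+-congˡ bₙ) (+-identityʳ _)))

  -- Here the copy carrying y keeps its index and the other one moves up, so that a gains a term at
  -- the left end. This is the growth of a bilateral series to the left, recorded with indices that
  -- start at 0.
  ∑-1+-shift : ∀ n {a b} y → a 0 ≈ y * b 0 → (∀ k → a (suc k) ≈ b k + y * b (suc k)) → y * b n ≈ 0# →
         ∑ (suc n) a ≈ (1# + y) * ∑ n b
  ∑-1+-shift n {a} {b} y a₀ aₛ bₙ = begin
    a 0 + ∑ n (λ k → a (suc k))                            ≈⟨ +-cong a₀ (∑-cong n aₛ) ⟩
    y * b 0 + ∑ n (λ k → b k + y * b (suc k))              ≈⟨ +-congˡ (∑-+ n _ _) ⟩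
    y * b 0 + (∑ n b + ∑ n (λ k → y * b (suc k)))          ≈⟨ solve 3 (λ p q r → p :+ (q :+ r) := q :+ (p :+ r)) refl _ _ _ ⟩
    ∑ n b + ∑ (suc n) (λ k → y * b k)                      ≈⟨ +-cong (*-identityˡ _) lem ⟨
    1# * ∑ n b + y * ∑ n b                                 ≈⟨ distribʳ _ _ _ ⟨
    (1# + y) * ∑ n b                                       ∎
    where
    lem : y * ∑ n b ≈ ∑ (suc n) (λ k → y * b k)
    lem = sym (trans (∑-last n _) (trans (+-congˡ bₙ) (trans (+-identityʳ _) (sym (∑-distribˡ n y b)))))

  term : Carrier → Carrier → ℤ → Carrier
  term u v j = u ^ tri j * v ^ tri (ℤ.- j)

  -- The first N factors of (-x; t)_∞.
  poch : ℕ → Carrier → Carrier → Carrier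
  poch N x t = ∏ N (λ i → 1# + x * t ^ i)

  module JacobiTripleProduct (u v : Carrier) (L N : ℕ) (uᴸ≈0 : u ^ L ≈ 0#) (vᴸ≈0 : v ^ L ≈ 0#)
                             (2L≤N : L ℕ.+ L ℕ.≤ N) where
    L≤N : L ℕ.≤ N
    L≤N = ℕ.≤-trans (ℕ.m≤m+n L L) 2L≤N

    t : Carrier
    t = u * v

    ^-t : ∀ n → t ^ n ≈ u ^ n * v ^ n
    ^-t = ^-distrib-* u v

    tⁿ≈0 : ∀ {n} → L ℕ.≤ n → t ^ n ≈ 0#
    tⁿ≈0 {n} L≤n = trans (^-t n) (trans (*-congʳ (^-nilpotent uᴸ≈0 L≤n)) (zeroˡ _))

    -- (t^(k+1); t)_∞
    C : ℕ → Carrier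
    C k = ∏ N (λ i → 1# - t ^ suc (k ℕ.+ i))

    C-one : ∀ {k} → L ℕ.≤ k → C k ≈ 1#
    C-one {k} L≤k = ∏-1 N λ i → 1-0≈1 (tⁿ≈0 (ℕ.≤-trans L≤k (ℕ.≤-trans (ℕ.m≤m+n k i) (ℕ.n≤1+n _))))

    -- This is `C k` = (1 - t^(k+1)) `C (suc k)`, put without subtraction so that the semiring
    -- solver can use it.
    C-step : ∀ k → C k + t ^ suc k * C (suc k) ≈ C (suc k)
    C-step k = begin
      C k + t ^ suc k * C (suc k)                              ≈⟨ +-congʳ factor ⟩
      (1# - t ^ suc k) * C (suc k) + t ^ suc k * C (suc k)     ≈⟨ distribʳ _ _ _ ⟨
      (1# - t ^ suc k + t ^ suc k) * C (suc k)                 ≈⟨ *-congʳ (1-x+x≈1 _) ⟩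
      1# * C (suc k)                                           ≈⟨ *-identityˡ _ ⟩
      C (suc k)                                                ∎
      where
      factor : C k ≈ (1# - t ^ suc k) * C (suc k)
      factor = begin
        C k                                            ≈⟨ *-identityʳ _ ⟨
        -- The next factor 1 - t^(k+1+N) equals 1 because N ≥ L. The finite product therefore
        -- satisfies the functional equation of the infinite one exactly.
        C k * 1#                                       ≈⟨ *-congˡ (1-0≈1 (tⁿ≈0 (ℕ.≤-trans L≤N
                                                            (ℕ.≤-trans (ℕ.m≤n+m N k) (ℕ.n≤1+n _))))) ⟨
        C k * (1# - t ^ suc (k ℕ.+ N))                 ≈⟨ ∏-last N _ ⟨
        ∏ (suc N) (λ i → 1# - t ^ suc (k ℕ.+ i))       ≈⟨ *-cong
            (+-congˡ (-‿cong (^-congʳ t (≡.cong suc (ℕ.+-identityʳ k)))))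
            (∏-cong N λ i → +-congˡ (-‿cong (^-congʳ t (≡.cong suc (ℕ.+-suc k i))))) ⟩
        (1# - t ^ suc k) * C (suc k)                   ∎

    -- Euler's series for (-x; t)_∞ has coefficients t^(k(k-1)/2) / (t; t)_k; multiplied by (t; t)_∞
    -- they need no division, as `C k` is (t; t)_∞ / (t; t)_k. The induction removes the factor 1 +
    -- x and passes to xt. The hypothesis says that m factors already exhaust the product, so in the
    -- base case x vanishes.
    euler : ∀ m x → x * t ^ m ≈ 0# →
            poch m x t * C 0 ≈ ∑ (suc N) (λ k → x ^ k * t ^ tri (ℤ.- (+ k)) * C k)
    euler zero x h = begin
      1# * C 0                                                     ≈⟨ *-congʳ (*-identityˡ 1#) ⟨
      1# * 1# * C 0                                                ≈⟨ +-identityʳ _ ⟨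
      1# * 1# * C 0 + 0#                                           ≈⟨ +-congˡ (∑-0 N λ k → trans
        (*-congʳ (trans (*-congʳ (trans (*-congʳ (trans (sym (*-identityʳ x)) h)) (zeroˡ _))) (zeroˡ _))) (zeroˡ _)) ⟨
      ∑ (suc N) (λ k → x ^ k * t ^ tri (ℤ.- (+ k)) * C k)          ∎
    euler (suc m) x h = begin
      (1# + x * 1#) * ∏ m (λ i → 1# + x * (t * t ^ i)) * C 0       ≈⟨ *-congʳ (*-cong (+-congˡ (*-identityʳ x))
                                                                        (∏-cong m λ i → +-congˡ (sym (*-assoc x t _)))) ⟩
      (1# + x) * poch m (x * t) t * C 0                            ≈⟨ *-assoc _ _ _ ⟩
      (1# + x) * (poch m (x * t) t * C 0)                          ≈⟨ *-congˡ (euler m (x * t) (trans (*-assoc _ _ _) h)) ⟩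
      (1# + x) * ∑ (suc N) b                                       ≈⟨ ∑-1+ N {a} {b} x refl recurrence last ⟨
      ∑ (suc N) a                                                  ∎
      where
      a b : ℕ → Carrier
      a k = x ^ k * t ^ tri (ℤ.- (+ k)) * C k
      b k = (x * t) ^ k * t ^ tri (ℤ.- (+ k)) * C k

      t^tri : ∀ k → t ^ triangular k ≈ t ^ k * t ^ tri (ℤ.- (+ k))
      t^tri zero    = sym (*-identityˡ 1#)
      t^tri (suc k) = ^-homo-* t (suc k) (triangular k)

      b≈ : ∀ k → b k ≈ x ^ k * t ^ triangular k * C k
      b≈ k = begin
        (x * t) ^ k * t ^ tri (ℤ.- (+ k)) * C k          ≈⟨ *-congʳ (*-congʳ (^-distrib-* x t k)) ⟩
        x ^ k * t ^ k * t ^ tri (ℤ.- (+ k)) * C k        ≈⟨ *-congʳ (*-assoc _ _ _) ⟩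
        x ^ k * (t ^ k * t ^ tri (ℤ.- (+ k))) * C k      ≈⟨ *-congʳ (*-congˡ (t^tri k)) ⟨
        x ^ k * t ^ triangular k * C k                   ∎

      recurrence : ∀ k → a (suc k) ≈ b (suc k) + x * b k
      recurrence k = begin
        x ^ suc k * τ * C (suc k)                                          ≈⟨ *-congˡ (C-step k) ⟨
        x * x ^ k * τ * (C k + t ^ suc k * C (suc k))
          ≈⟨ solve 6 (λ x p τ c s d → x :* p :* τ :* (c :+ s :* d) := x :* p :* (s :* τ) :* d :+ x :* (p :* τ :* c))
               refl x (x ^ k) τ (C k) (t ^ suc k) (C (suc k)) ⟩
        x * x ^ k * (t ^ suc k * τ) * C (suc k) + x * (x ^ k * τ * C k)
          ≈⟨ +-cong (trans (b≈ (suc k)) (*-congʳ (*-congˡ (^-homo-* t (suc k) (triangular k))))) (*-congˡ (b≈ k)) ⟨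
        b (suc k) + x * b k                                                ∎
        where
        τ : Carrier
        τ = t ^ triangular k

      last : x * b N ≈ 0#
      last = begin
        x * b N                                     ≈⟨ *-congˡ (b≈ N) ⟩
        x * (x ^ N * t ^ triangular N * C N)        ≈⟨ *-congˡ (*-congʳ (*-congˡ (tⁿ≈0 (ℕ.≤-trans L≤N (n≤triangular N))))) ⟩
        x * (x ^ N * 0# * C N)                      ≈⟨ solve 3 (λ x p c → x :* (p :* con 0 :* c) := con 0) refl x _ _ ⟩
        0#                                          ∎

    w : ℤ → Carrier
    w = term u v

    -- For j ≥ 0 the power of u vanishes and for j < 0 that of v, since on its own side the
    -- triangular exponent is at least |j|.
    w-supported : Supportedℤ L w
    w-supported (+ n)    h = trans (*-congʳ (^-nilpotent uᴸ≈0 (ℕ.≤-trans h (n≤triangular n)))) (zeroˡ _)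
    w-supported -[1+ n ] h = trans (*-congˡ (^-nilpotent vᴸ≈0 (ℕ.≤-trans h (n≤triangular (suc n))))) (zeroʳ _)

    w-shift : ∀ n k → v * t ^ n * w (k ⊖ n) ≈ t ^ k * w (k ⊖ suc n)
    w-shift n k = begin
      v * t ^ n * w (k ⊖ n)                          ≈⟨ *-congʳ (*-congˡ (^-t n)) ⟩
      v * (u ^ n * v ^ n) * (u ^ tri i * v ^ tri (ℤ.- i))
        ≈⟨ solve 5 (λ v a b c d → v :* (a :* b) :* (c :* d) := c :* a :* (d :* (v :* b))) refl v _ _ _ _ ⟩
      u ^ tri i * u ^ n * (v ^ tri (ℤ.- i) * v ^ suc n)  ≈⟨ *-cong (^-homo-* u (tri i) n) (^-homo-* v (tri (ℤ.- i)) (suc n)) ⟨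
      u ^ (tri i ℕ.+ n) * v ^ (tri (ℤ.- i) ℕ.+ suc n)    ≈⟨ *-cong (^-congʳ u (tri-shift n k)) (^-congʳ v (tri-shift- n k)) ⟩
      u ^ (tri j ℕ.+ k) * v ^ (tri (ℤ.- j) ℕ.+ k)        ≈⟨ *-cong (^-homo-* u (tri j) k) (^-homo-* v (tri (ℤ.- j)) k) ⟩
      u ^ tri j * u ^ k * (v ^ tri (ℤ.- j) * v ^ k)
        ≈⟨ solve 4 (λ a b c d → a :* b :* (c :* d) := b :* d :* (a :* c)) refl _ _ _ _ ⟩
      u ^ k * v ^ k * (u ^ tri j * v ^ tri (ℤ.- j))      ≈⟨ *-congʳ (^-t k) ⟨
      t ^ k * w (k ⊖ suc n)                              ∎
      where
      i j : ℤ
      i = k ⊖ n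
      j = k ⊖ suc n

    -- The expansion of (-u; t)_∞ (t; t)_∞ times the first n factors 1 + v tⁱ. It is Euler's series
    -- for n = 0. Each factor adds a term on the left, and the weights are counted from the left
    -- end, so that for n = N they have become 1 on the whole support of `w`.
    S : ℕ → Carrier
    S n = ∑ (n ℕ.+ suc N) (λ k → w (k ⊖ n) * C k)

    -- The quasi-periodicity `w-shift` turns v tⁿ times one term into tᵏ times its left neighbour,
    -- and `C-step` absorbs exactly this power of t into the weight.
    S-step : ∀ n → S (suc n) ≈ (1# + v * t ^ n) * S n
    S-step n = ∑-1+-shift (n ℕ.+ suc N) {λ k → w (k ⊖ suc n) * C k} {λ k → w (k ⊖ n) * C k} (v * t ^ n) first recurrence last
      where
      first : w (0 ⊖ suc n) * C 0 ≈ v * t ^ n * (w (0 ⊖ n) * C 0)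
      first = begin
        w (0 ⊖ suc n) * C 0                ≈⟨ *-congʳ (*-identityˡ _) ⟨
        1# * w (0 ⊖ suc n) * C 0           ≈⟨ *-congʳ (w-shift n 0) ⟨
        v * t ^ n * w (0 ⊖ n) * C 0        ≈⟨ *-assoc _ _ _ ⟩
        v * t ^ n * (w (0 ⊖ n) * C 0)      ∎

      recurrence : ∀ k → w (suc k ⊖ suc n) * C (suc k) ≈
                         w (k ⊖ n) * C k + v * t ^ n * (w (suc k ⊖ n) * C (suc k))
      recurrence k = begin
        w (suc k ⊖ suc n) * C (suc k)                    ≈⟨ *-congˡ (C-step k) ⟨
        w (suc k ⊖ suc n) * (C k + t ^ suc k * C (suc k))
          ≈⟨ solve 4 (λ w c s d → w :* (c :+ s :* d) := w :* c :+ s :* w :* d) refl _ _ _ _ ⟩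
        w (suc k ⊖ suc n) * C k + t ^ suc k * w (suc k ⊖ suc n) * C (suc k)
          ≈⟨ +-cong (*-congʳ (reflexive (≡.cong w (ℤ.[1+m]⊖[1+n]≡m⊖n k n)))) (*-congʳ (sym (w-shift n (suc k)))) ⟩
        w (k ⊖ n) * C k + v * t ^ n * w (suc k ⊖ n) * C (suc k)
          ≈⟨ +-congˡ (*-assoc _ _ _) ⟩
        w (k ⊖ n) * C k + v * t ^ n * (w (suc k ⊖ n) * C (suc k)) ∎

      last : v * t ^ n * (w (n ℕ.+ suc N ⊖ n) * C (n ℕ.+ suc N)) ≈ 0#
      last = trans (*-congˡ (trans (*-congʳ (w-supported (n ℕ.+ suc N ⊖ n) (ℕ.≤-trans (ℕ.≤-trans L≤N (ℕ.n≤1+n N))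
        (ℕ.≤-reflexive (≡.sym (≡.cong ∣_∣ (≡.trans (ℤ.⊖-≥ (ℕ.m≤m+n n (suc N))) (≡.cong +_ (ℕ.m+n∸m≡n n (suc N)))))))))) (zeroˡ _))) (zeroʳ _)

    S-zero : poch N u t * C 0 ≈ S 0
    S-zero = trans (euler N u (trans (*-congˡ (tⁿ≈0 L≤N)) (zeroʳ u)))
      (∑-cong (suc N) λ k → *-congʳ {C k} (u^k*t^tri k))
      where
      u^k*t^tri : ∀ k → u ^ k * t ^ tri (ℤ.- (+ k)) ≈ w (+ k)
      u^k*t^tri zero    = refl
      u^k*t^tri (suc k) = begin
        u ^ suc k * t ^ triangular k                           ≈⟨ *-congˡ (^-t (triangular k)) ⟩
        u ^ suc k * (u ^ triangular k * v ^ triangular k)      ≈⟨ *-assoc _ _ _ ⟨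
        u ^ suc k * u ^ triangular k * v ^ triangular k        ≈⟨ *-congʳ (^-homo-* u (suc k) (triangular k)) ⟨
        w (+ suc k)                                            ∎

    S-poch : ∀ n → poch n v t * S 0 ≈ S n
    S-poch zero    = *-identityˡ _
    S-poch (suc n) = begin
      poch (suc n) v t * S 0                      ≈⟨ *-congʳ (∏-last n _) ⟩
      poch n v t * (1# + v * t ^ n) * S 0         ≈⟨ solve 3 (λ p a s → p :* a :* s := a :* (p :* s)) refl _ _ _ ⟩
      (1# + v * t ^ n) * (poch n v t * S 0)       ≈⟨ *-congˡ (S-poch n) ⟩
      (1# + v * t ^ n) * S n                      ≈⟨ S-step n ⟨
      S (suc n)                                   ∎

    S-limit : S N ≈ ∑ℤ N w
    S-limit = begin
      ∑ (N ℕ.+ suc N) (λ k → w (k ⊖ N) * C k)     ≈⟨ ∑-cong (N ℕ.+ suc N) drop-C ⟩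
      ∑ (N ℕ.+ suc N) (λ k → w (k ⊖ N))           ≈⟨ reflexive (≡.cong (λ n → ∑ n (λ k → w (k ⊖ N)))
                                                      (≡.trans (ℕ.+-suc N N) (≡.cong suc N+N))) ⟩
      ∑ (suc (N ℕ.* 2)) (λ k → w (k ⊖ N))         ≈⟨ ∑-last (N ℕ.* 2) _ ⟩
      ∑ℤ N w + w (N ℕ.* 2 ⊖ N)                    ≈⟨ +-congˡ (w-supported (N ℕ.* 2 ⊖ N)
                                                      (ℕ.≤-trans L≤N (ℕ.≤-reflexive (≡.cong ∣_∣ (≡.sym (n*2⊖n N)))))) ⟩
      ∑ℤ N w + 0#                                 ≈⟨ +-identityʳ _ ⟩
      ∑ℤ N w                                      ∎
      where
      N+N : N ℕ.+ N ≡ N ℕ.* 2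
      N+N = ≡.sym (≡.trans (ℕ.*-comm N 2) (≡.cong (N ℕ.+_) (ℕ.+-identityʳ N)))

      drop-C : ∀ k → w (k ⊖ N) * C k ≈ w (k ⊖ N)
      -- For k ≥ L the weight is 1. For k < L the index k - N has absolute value at least N - L ≥ L,
      -- where `w` vanishes; this uses N ≥ 2L.
      drop-C k with L ℕ.≤? k
      ... | yes L≤k = trans (*-congˡ (C-one L≤k)) (*-identityʳ _)
      ... | no  L≰k = trans (trans (*-congʳ w≈0) (zeroˡ _)) (sym w≈0)
        where
        k<L : k ℕ.< L
        k<L = ℕ.≰⇒> L≰k
        w≈0 : w (k ⊖ N) ≈ 0#
        w≈0 = w-supported (k ⊖ N) (ℕ.≤-trans (ℕ.m+n≤o⇒m≤o∸n L
          (ℕ.≤-trans (ℕ.+-monoʳ-≤ L (ℕ.<⇒≤ k<L)) 2L≤N))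
          (ℕ.≤-reflexive (≡.sym (ℤ.∣⊖∣-≤ (ℕ.≤-trans (ℕ.<⇒≤ k<L) L≤N)))))

    jacobi : poch N v t * (poch N u t * ∏ N (λ i → 1# - t ^ suc i)) ≈ ∑ℤ N w
    jacobi = trans (*-congˡ S-zero) (trans (S-poch N) S-limit)

-- The theta identity

-- The exponent of a variable in `term u v j` when u contains it to the power a and v to the power
-- b.
lin : ℕ → ℕ → ℤ → ℕ
lin a b j = a ℕ.* tri j ℕ.+ b ℕ.* tri (ℤ.- j)

half-lin : ∀ a b j → Half (lin a b j) (+ a ℤ.* (j ℤ.* j ℤ.+ j) ℤ.+ + b ℤ.* (j ℤ.* j ℤ.- j))
half-lin a b j = half-+ (half-* a (half (2*tri j))) (half-* b (half (2*tri- j)))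

-- In this and the next three lemmas the constants are the exponents of x, or of r, in the theta
-- arguments: r, x²r and xr, xr before the change of index; xr², x³r² (even) or x³r⁴, x (odd) after
-- it. The mixed terms mn cancel because (m + n)² + (m - n)² = 2m² + 2n²; the lone 1 in `odd-r` is
-- the factor r of the second square.
even-x : ∀ m n → lin 0 2 (m ℤ.+ n) ℕ.+ lin 1 1 (m ℤ.- n) ≡ lin 1 3 m ℕ.+ lin 1 3 n
even-x m n = half-unique (half-+ (half-lin 0 2 (m ℤ.+ n)) (half-lin 1 1 (m ℤ.- n))) (step m n)
                         (half-+ (half-lin 1 3 m) (half-lin 1 3 n))
  where
  step : ∀ m n →
    + 0 ℤ.* ((m ℤ.+ n) ℤ.* (m ℤ.+ n) ℤ.+ (m ℤ.+ n)) ℤ.+ + 2 ℤ.* ((m ℤ.+ n) ℤ.* (m ℤ.+ n) ℤ.- (m ℤ.+ n)) ℤ.+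
    (+ 1 ℤ.* ((m ℤ.- n) ℤ.* (m ℤ.- n) ℤ.+ (m ℤ.- n)) ℤ.+ + 1 ℤ.* ((m ℤ.- n) ℤ.* (m ℤ.- n) ℤ.- (m ℤ.- n))) ≡
    + 1 ℤ.* (m ℤ.* m ℤ.+ m) ℤ.+ + 3 ℤ.* (m ℤ.* m ℤ.- m) ℤ.+ (+ 1 ℤ.* (n ℤ.* n ℤ.+ n) ℤ.+ + 3 ℤ.* (n ℤ.* n ℤ.- n))
  step = ℤ-solve-∀

even-r : ∀ m n → lin 1 1 (m ℤ.+ n) ℕ.+ lin 1 1 (m ℤ.- n) ≡ lin 2 2 m ℕ.+ lin 2 2 n
even-r m n = half-unique (half-+ (half-lin 1 1 (m ℤ.+ n)) (half-lin 1 1 (m ℤ.- n))) (step m n)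
                         (half-+ (half-lin 2 2 m) (half-lin 2 2 n))
  where
  step : ∀ m n →
    + 1 ℤ.* ((m ℤ.+ n) ℤ.* (m ℤ.+ n) ℤ.+ (m ℤ.+ n)) ℤ.+ + 1 ℤ.* ((m ℤ.+ n) ℤ.* (m ℤ.+ n) ℤ.- (m ℤ.+ n)) ℤ.+
    (+ 1 ℤ.* ((m ℤ.- n) ℤ.* (m ℤ.- n) ℤ.+ (m ℤ.- n)) ℤ.+ + 1 ℤ.* ((m ℤ.- n) ℤ.* (m ℤ.- n) ℤ.- (m ℤ.- n))) ≡
    + 2 ℤ.* (m ℤ.* m ℤ.+ m) ℤ.+ + 2 ℤ.* (m ℤ.* m ℤ.- m) ℤ.+ (+ 2 ℤ.* (n ℤ.* n ℤ.+ n) ℤ.+ + 2 ℤ.* (n ℤ.* n ℤ.- n))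
  step = ℤ-solve-∀

odd-x : ∀ m n → lin 0 2 (m ℤ.+ n ℤ.+ + 1) ℕ.+ lin 1 1 (m ℤ.- n) ≡ lin 3 1 m ℕ.+ lin 3 1 n
odd-x m n = half-unique (half-+ (half-lin 0 2 (m ℤ.+ n ℤ.+ + 1)) (half-lin 1 1 (m ℤ.- n))) (step m n)
                        (half-+ (half-lin 3 1 m) (half-lin 3 1 n))
  where
  step : ∀ m n →
    + 0 ℤ.* ((m ℤ.+ n ℤ.+ + 1) ℤ.* (m ℤ.+ n ℤ.+ + 1) ℤ.+ (m ℤ.+ n ℤ.+ + 1)) ℤ.+
    + 2 ℤ.* ((m ℤ.+ n ℤ.+ + 1) ℤ.* (m ℤ.+ n ℤ.+ + 1) ℤ.- (m ℤ.+ n ℤ.+ + 1)) ℤ.+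
    (+ 1 ℤ.* ((m ℤ.- n) ℤ.* (m ℤ.- n) ℤ.+ (m ℤ.- n)) ℤ.+ + 1 ℤ.* ((m ℤ.- n) ℤ.* (m ℤ.- n) ℤ.- (m ℤ.- n))) ≡
    + 3 ℤ.* (m ℤ.* m ℤ.+ m) ℤ.+ + 1 ℤ.* (m ℤ.* m ℤ.- m) ℤ.+ (+ 3 ℤ.* (n ℤ.* n ℤ.+ n) ℤ.+ + 1 ℤ.* (n ℤ.* n ℤ.- n))
  step = ℤ-solve-∀

odd-r : ∀ m n → lin 1 1 (m ℤ.+ n ℤ.+ + 1) ℕ.+ lin 1 1 (m ℤ.- n) ≡ 1 ℕ.+ (lin 4 0 m ℕ.+ lin 4 0 n)
odd-r m n = half-unique (half-+ (half-lin 1 1 (m ℤ.+ n ℤ.+ + 1)) (half-lin 1 1 (m ℤ.- n))) (step m n)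
                        (half-+ (half-2* 1) (half-+ (half-lin 4 0 m) (half-lin 4 0 n)))
  where
  step : ∀ m n →
    + 1 ℤ.* ((m ℤ.+ n ℤ.+ + 1) ℤ.* (m ℤ.+ n ℤ.+ + 1) ℤ.+ (m ℤ.+ n ℤ.+ + 1)) ℤ.+
    + 1 ℤ.* ((m ℤ.+ n ℤ.+ + 1) ℤ.* (m ℤ.+ n ℤ.+ + 1) ℤ.- (m ℤ.+ n ℤ.+ + 1)) ℤ.+
    (+ 1 ℤ.* ((m ℤ.- n) ℤ.* (m ℤ.- n) ℤ.+ (m ℤ.- n)) ℤ.+ + 1 ℤ.* ((m ℤ.- n) ℤ.* (m ℤ.- n) ℤ.- (m ℤ.- n))) ≡
    + 2 ℤ.* + 1 ℤ.+ (+ 4 ℤ.* (m ℤ.* m ℤ.+ m) ℤ.+ + 0 ℤ.* (m ℤ.* m ℤ.- m) ℤ.+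
                     (+ 4 ℤ.* (n ℤ.* n ℤ.+ n) ℤ.+ + 0 ℤ.* (n ℤ.* n ℤ.- n)))
  step = ℤ-solve-∀

module ThetaIdentity {c ℓ} (R : CommutativeRing c ℓ) where
  open CommutativeRing R
  open import Relation.Binary.Reasoning.Setoid setoid
  open import Algebra.Properties.Semiring.Exp semiring
  open import Algebra.Properties.CommutativeSemiring.Exp commutativeSemiring using (^-distrib-*)
  open import Algebra.Solver.Ring.NaturalCoefficients.Default commutativeSemiring
    using (solve; _:=_; _:*_)
  open RingLemmas R

  theta : ℕ → Carrier → Carrier → Carrier
  theta n u v = poch n v (u * v) * (poch n u (u * v) * ∏ n (λ i → 1# - (u * v) ^ suc i))

  module _ (x r : Carrier) where

    mon : ℕ → ℕ → Carrier
    mon a b = x ^ a * r ^ b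

    mon-* : ∀ a b a′ b′ → mon a b * mon a′ b′ ≈ mon (a ℕ.+ a′) (b ℕ.+ b′)
    mon-* a b a′ b′ = trans
      (solve 4 (λ p q r s → p :* q :* (r :* s) := p :* r :* (q :* s)) refl _ _ _ _)
      (sym (*-cong (^-homo-* x a a′) (^-homo-* r b b′)))

    mon-cong : ∀ {a b a′ b′} → a ≡ a′ → b ≡ b′ → mon a b ≈ mon a′ b′
    mon-cong ≡.refl ≡.refl = refl

    mon-^ : ∀ a b n → mon a b ^ n ≈ mon (a ℕ.* n) (b ℕ.* n)
    mon-^ a b n = trans (^-distrib-* (x ^ a) (r ^ b) n) (*-cong (^-assocʳ x a n) (^-assocʳ r b n))

    term-mon : ∀ a b a′ b′ j → term (mon a b) (mon a′ b′) j ≈ mon (lin a a′ j) (lin b b′ j)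
    term-mon a b a′ b′ j = trans (*-cong (mon-^ a b (tri j)) (mon-^ a′ b′ (tri (ℤ.- j)))) (mon-* (a ℕ.* tri j) (b ℕ.* tri j) _ _)

    module _ (L N : ℕ) (xᴸ≈0 : x ^ L ≈ 0#) (rᴸ≈0 : r ^ L ≈ 0#) (2L≤N : L ℕ.* 2 ℕ.≤ N) where

      mon-nilpotentˣ : ∀ a b → mon (suc a) b ^ L ≈ 0#
      mon-nilpotentˣ a b = trans (mon-^ (suc a) b L) (trans (*-congʳ (^-nilpotent xᴸ≈0 (ℕ.m≤n*m L (suc a)))) (zeroˡ _))

      mon-nilpotentʳ : ∀ a b → mon a (suc b) ^ L ≈ 0#
      mon-nilpotentʳ a b = trans (mon-^ a (suc b) L) (trans (*-congˡ (^-nilpotent rᴸ≈0 (ℕ.m≤n*m L (suc b)))) (zeroʳ _))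

      L+L≤N : L ℕ.+ L ℕ.≤ N
      L+L≤N = ℕ.≤-trans (ℕ.≤-reflexive (≡.sym (≡.trans (ℕ.*-comm L 2) (≡.cong (L ℕ.+_) (ℕ.+-identityʳ L))))) 2L≤N

      L+L≤2N : L ℕ.+ L ℕ.≤ N ℕ.* 2
      L+L≤2N = ℕ.≤-trans L+L≤N (ℕ.m≤m*n N 2)

      private module A = JacobiTripleProduct (mon 1 2) (mon 3 2) L N (mon-nilpotentˣ 0 2) (mon-nilpotentˣ 2 2) L+L≤N
      module B = JacobiTripleProduct (mon 3 4) (mon 1 0) L N (mon-nilpotentˣ 2 4) (mon-nilpotentˣ 0 0) L+L≤N
      -- The index a = m + n ranges twice as far as m and n, hence the doubled window for the two
      -- series of the right side.
      module C = JacobiTripleProduct (mon 0 1) (mon 2 1) L (N ℕ.* 2) (mon-nilpotentʳ 0 0) (mon-nilpotentˣ 1 1) L+L≤2N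
      module D = JacobiTripleProduct (mon 1 1) (mon 1 1) L (N ℕ.* 2) (mon-nilpotentˣ 0 1) (mon-nilpotentˣ 0 1) L+L≤2N

      g : ℤ → ℤ → Carrier
      g a b = C.w a * D.w b

      even≈ : ∀ m n → g (m ℤ.+ n) (m ℤ.- n) ≈ A.w m * A.w n
      even≈ m n = begin
        g (m ℤ.+ n) (m ℤ.- n)
          ≈⟨ *-cong (term-mon 0 1 2 1 (m ℤ.+ n)) (term-mon 1 1 1 1 (m ℤ.- n)) ⟩
        mon (lin 0 2 (m ℤ.+ n)) (lin 1 1 (m ℤ.+ n)) * mon (lin 1 1 (m ℤ.- n)) (lin 1 1 (m ℤ.- n))
          ≈⟨ mon-* (lin 0 2 (m ℤ.+ n)) (lin 1 1 (m ℤ.+ n)) (lin 1 1 (m ℤ.- n)) (lin 1 1 (m ℤ.- n)) ⟩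
        mon (lin 0 2 (m ℤ.+ n) ℕ.+ lin 1 1 (m ℤ.- n)) (lin 1 1 (m ℤ.+ n) ℕ.+ lin 1 1 (m ℤ.- n))
          ≈⟨ mon-cong (even-x m n) (even-r m n) ⟩
        mon (lin 1 3 m ℕ.+ lin 1 3 n) (lin 2 2 m ℕ.+ lin 2 2 n)
          ≈⟨ mon-* (lin 1 3 m) (lin 2 2 m) (lin 1 3 n) (lin 2 2 n) ⟨
        mon (lin 1 3 m) (lin 2 2 m) * mon (lin 1 3 n) (lin 2 2 n)
          ≈⟨ *-cong (term-mon 1 2 3 2 m) (term-mon 1 2 3 2 n) ⟨
        A.w m * A.w n ∎

      odd≈ : ∀ m n → g (m ℤ.+ n ℤ.+ + 1) (m ℤ.- n) ≈ mon 0 1 * (B.w m * B.w n)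
      odd≈ m n = begin
        g (m ℤ.+ n ℤ.+ + 1) (m ℤ.- n)
          ≈⟨ *-cong (term-mon 0 1 2 1 (m ℤ.+ n ℤ.+ + 1)) (term-mon 1 1 1 1 (m ℤ.- n)) ⟩
        mon (lin 0 2 (m ℤ.+ n ℤ.+ + 1)) (lin 1 1 (m ℤ.+ n ℤ.+ + 1)) * mon (lin 1 1 (m ℤ.- n)) (lin 1 1 (m ℤ.- n))
          ≈⟨ mon-* (lin 0 2 (m ℤ.+ n ℤ.+ + 1)) (lin 1 1 (m ℤ.+ n ℤ.+ + 1)) (lin 1 1 (m ℤ.- n)) (lin 1 1 (m ℤ.- n)) ⟩
        mon (lin 0 2 (m ℤ.+ n ℤ.+ + 1) ℕ.+ lin 1 1 (m ℤ.- n)) (lin 1 1 (m ℤ.+ n ℤ.+ + 1) ℕ.+ lin 1 1 (m ℤ.- n))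
          ≈⟨ mon-cong (odd-x m n) (odd-r m n) ⟩
        mon (lin 3 1 m ℕ.+ lin 3 1 n) (1 ℕ.+ (lin 4 0 m ℕ.+ lin 4 0 n))
          ≈⟨ mon-* 0 1 (lin 3 1 m ℕ.+ lin 3 1 n) (lin 4 0 m ℕ.+ lin 4 0 n) ⟨
        mon 0 1 * mon (lin 3 1 m ℕ.+ lin 3 1 n) (lin 4 0 m ℕ.+ lin 4 0 n)
          ≈⟨ *-congˡ (mon-* (lin 3 1 m) (lin 4 0 m) (lin 3 1 n) (lin 4 0 n)) ⟨
        mon 0 1 * (mon (lin 3 1 m) (lin 4 0 m) * mon (lin 3 1 n) (lin 4 0 n))
          ≈⟨ *-congˡ (*-cong (term-mon 3 4 1 0 m) (term-mon 3 4 1 0 n)) ⟨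
        mon 0 1 * (B.w m * B.w n) ∎

      theta-identity : theta N (mon 1 2) (mon 3 2) * theta N (mon 1 2) (mon 3 2) +
                       mon 0 1 * (theta N (mon 3 4) (mon 1 0) * theta N (mon 3 4) (mon 1 0)) ≈
                       theta (N ℕ.* 2) (mon 0 1) (mon 2 1) * theta (N ℕ.* 2) (mon 1 1) (mon 1 1)
      theta-identity = begin
        theta N (mon 1 2) (mon 3 2) * theta N (mon 1 2) (mon 3 2) +
        mon 0 1 * (theta N (mon 3 4) (mon 1 0) * theta N (mon 3 4) (mon 1 0))
          ≈⟨ +-cong (*-cong A.jacobi A.jacobi) (*-congˡ (*-cong B.jacobi B.jacobi)) ⟩
        ∑ℤ N A.w * ∑ℤ N A.w + mon 0 1 * (∑ℤ N B.w * ∑ℤ N B.w)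
          ≈⟨ +-cong (∑ℤ-* N N A.w A.w) (trans (*-congˡ (∑ℤ-* N N B.w B.w)) (trans
               (∑ℤ-distribˡ N (mon 0 1) (λ m → ∑ℤ N (λ n → B.w m * B.w n)))
               (∑ℤ-cong N (λ m → ∑ℤ-distribˡ N (mon 0 1) (λ n → B.w m * B.w n))))) ⟩
        ∑ℤ N (λ m → ∑ℤ N (λ n → A.w m * A.w n)) + ∑ℤ N (λ m → ∑ℤ N (λ n → mon 0 1 * (B.w m * B.w n)))
          ≈⟨ +-cong (∑ℤ-cong N (λ m → ∑ℤ-cong N (even≈ m))) (∑ℤ-cong N (λ m → ∑ℤ-cong N (odd≈ m))) ⟨
        ∑ℤ N (λ m → ∑ℤ N (λ n → g (m ℤ.+ n) (m ℤ.- n))) + ∑ℤ N (λ m → ∑ℤ N (λ n → g (m ℤ.+ n ℤ.+ + 1) (m ℤ.- n)))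
          ≈⟨ ∑ℤ-parity N g 2L≤N
               (λ a b h → trans (*-congʳ (C.w-supported a h)) (zeroˡ _))
               (λ a b h → trans (*-congˡ (D.w-supported b h)) (zeroʳ _))
               (λ m n h → trans (even≈ m n) (trans (*-congʳ (A.w-supported m h)) (zeroˡ _)))
               (λ m n h → trans (even≈ m n) (trans (*-congˡ (A.w-supported n h)) (zeroʳ _)))
               (λ m n h → trans (odd≈ m n) (trans (*-congˡ (trans (*-congʳ (B.w-supported m h)) (zeroˡ _))) (zeroʳ _)))
               (λ m n h → trans (odd≈ m n) (trans (*-congˡ (trans (*-congˡ (B.w-supported n h)) (zeroʳ _))) (zeroʳ _))) ⟨
        ∑ℤ (N ℕ.* 2) (λ a → ∑ℤ (N ℕ.* 2) (g a))
          ≈⟨ ∑ℤ-* (N ℕ.* 2) (N ℕ.* 2) C.w D.w ⟨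
        ∑ℤ (N ℕ.* 2) C.w * ∑ℤ (N ℕ.* 2) D.w
          ≈⟨ *-cong C.jacobi D.jacobi ⟨
        theta (N ℕ.* 2) (mon 0 1) (mon 2 1) * theta (N ℕ.* 2) (mon 1 1) (mon 1 1) ∎

-- The product identity

module ProductIdentity {c ℓ} (R : CommutativeRing c ℓ)
  (q : CommutativeRing.Carrier R) (M : ℕ) where
  open CommutativeRing R
  open import Relation.Binary.Reasoning.Setoid setoid
  open import Algebra.Properties.Semiring.Exp semiring
  open import Algebra.Properties.CommutativeSemiring.Exp commutativeSemiring using (^-distrib-*)
  open import Algebra.Properties.Ring ring using (-‿distribˡ-*; -1*x≈-x; -‿involutive)
  open import Algebra.Solver.Ring.NaturalCoefficients.Default commutativeSemiring
    using (solve; _:=_; _:+_; _:*_; con)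
  open RingLemmas R
  open ThetaIdentity R

  -- All thetas used have arguments whose M-th power is 0, and the parity split asks for twice this
  -- bound.
  N : ℕ
  N = M ℕ.* 2

  -- The first n factors of (q^a; q^c)_∞; likewise `G⁺` for (-q^a; q^c)_∞. `Q a` stands for (q^a;
  -- q^76)_∞.
  G : ℕ → ℕ → ℕ → Carrier
  G c n a = ∏ n (λ i → 1# - q ^ (a ℕ.+ i ℕ.* c))

  G⁺ : ℕ → ℕ → ℕ → Carrier
  G⁺ c n a = ∏ n (λ i → 1# + q ^ (a ℕ.+ i ℕ.* c))

  Q : ℕ → Carrier
  Q = G 76 N

  -- An atom for -1, so that signs obey the laws of powers and pass through the semiring solver.
  s : Carrier
  s = - 1#

  s*s≈1 : s * s ≈ 1#
  s*s≈1 = trans (-1*x≈-x s) (-‿involutive 1#)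

  s^even : ∀ n → s ^ (n ℕ.* 2) ≈ 1#
  s^even zero    = refl
  s^even (suc n) = trans (sym (*-assoc s s _)) (trans (*-cong s*s≈1 (s^even n)) (*-identityˡ 1#))

  q^-progression : ∀ a c i → q ^ a * (q ^ c) ^ i ≈ q ^ (a ℕ.+ i ℕ.* c)
  q^-progression a c i = trans (*-congˡ (trans (^-assocʳ q c i) (^-congʳ q (ℕ.*-comm c i)))) (sym (^-homo-* q a _))

  poch⁻ : ∀ n {u t} a c → u ≈ s * q ^ a → t ≈ q ^ c → poch n u t ≈ G c n a
  poch⁻ n {u} {t} a c hu ht = ∏-cong n λ i → +-congˡ (begin
    u * t ^ i                    ≈⟨ *-cong hu (^-congˡ i ht) ⟩
    s * q ^ a * (q ^ c) ^ i      ≈⟨ *-assoc _ _ _ ⟩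
    s * (q ^ a * (q ^ c) ^ i)    ≈⟨ *-congˡ (q^-progression a c i) ⟩
    s * q ^ (a ℕ.+ i ℕ.* c)      ≈⟨ -1*x≈-x _ ⟩
    - (q ^ (a ℕ.+ i ℕ.* c))      ∎)

  poch⁺ : ∀ n {u t} a c → u ≈ q ^ a → t ≈ q ^ c → poch n u t ≈ G⁺ c n a
  poch⁺ n {u} {t} a c hu ht = ∏-cong n λ i → +-congˡ (trans (*-cong hu (^-congˡ i ht)) (q^-progression a c i))

  poch-q : ∀ n {t} c → t ≈ q ^ c → ∏ n (λ i → 1# - t ^ suc i) ≈ G c n c
  poch-q n c ht = ∏-cong n λ i → +-congˡ (-‿cong (trans (*-cong ht (^-congˡ i ht)) (q^-progression c c i)))

  theta⁻ : ∀ n {u v} a b → u ≈ s * q ^ a → v ≈ s * q ^ b →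
           theta n u v ≈ G (a ℕ.+ b) n b * (G (a ℕ.+ b) n a * G (a ℕ.+ b) n (a ℕ.+ b))
  theta⁻ n {u} {v} a b hu hv = *-cong (poch⁻ n b (a ℕ.+ b) hv ht) (*-cong (poch⁻ n a (a ℕ.+ b) hu ht) (poch-q n (a ℕ.+ b) ht))
    where
    ht : u * v ≈ q ^ (a ℕ.+ b)
    ht = begin
      u * v                                ≈⟨ *-cong hu hv ⟩
      s * q ^ a * (s * q ^ b)              ≈⟨ solve 3 (λ s x y → s :* x :* (s :* y) := s :* s :* (x :* y)) refl s _ _ ⟩
      s * s * (q ^ a * q ^ b)              ≈⟨ *-cong s*s≈1 (sym (^-homo-* q a b)) ⟩
      1# * q ^ (a ℕ.+ b)                   ≈⟨ *-identityˡ _ ⟩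
      q ^ (a ℕ.+ b)                        ∎

  theta⁺ : ∀ n {u v} a b → u ≈ q ^ a → v ≈ q ^ b →
           theta n u v ≈ G⁺ (a ℕ.+ b) n b * (G⁺ (a ℕ.+ b) n a * G (a ℕ.+ b) n (a ℕ.+ b))
  theta⁺ n {u} {v} a b hu hv = *-cong (poch⁺ n b (a ℕ.+ b) hv ht) (*-cong (poch⁺ n a (a ℕ.+ b) hu ht) (poch-q n (a ℕ.+ b) ht))
    where
    ht : u * v ≈ q ^ (a ℕ.+ b)
    ht = trans (*-cong hu hv) (sym (^-homo-* q a b))

  -- The factors with even i and those with odd i each form a progression of step 76.
  G-halve : ∀ a → G 38 (N ℕ.* 2) a ≈ Q a * Q (38 ℕ.+ a)
  G-halve a = trans (∏-pairs N _) (trans (∏-* N _ _) (*-cong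
    (∏-cong N λ i → +-congˡ (-‿cong (^-congʳ q (even-exp a i))))
    (∏-cong N λ i → +-congˡ (-‿cong (^-congʳ q (odd-exp a i))))))
    where
    even-exp : ∀ a i → a ℕ.+ i ℕ.* 2 ℕ.* 38 ≡ a ℕ.+ i ℕ.* 76
    even-exp = ℕ-solve-∀
    odd-exp : ∀ a i → a ℕ.+ suc (i ℕ.* 2) ℕ.* 38 ≡ 38 ℕ.+ a ℕ.+ i ℕ.* 76
    odd-exp = ℕ-solve-∀

  [1-x][1+x] : ∀ x → (1# - x) * (1# + x) ≈ 1# - x * x
  [1-x][1+x] x = begin
    (1# - x) * (1# + x)                ≈⟨ solve 2 (λ x y → (con 1 :+ y) :* (con 1 :+ x) := con 1 :+ y :* x :+ (y :+ x)) refl x (- x) ⟩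
    1# + - x * x + (- x + x)           ≈⟨ +-cong (+-congˡ (sym (-‿distribˡ-* x x))) (-‿inverseˡ x) ⟩
    1# - x * x + 0#                    ≈⟨ +-identityʳ _ ⟩
    1# - x * x                         ∎

  module _ (qᴹ≈0 : q ^ M ≈ 0#) where

    -- Difference of squares, factor by factor. The product obtained has 2N factors, of which the
    -- last N equal 1 because q^M = 0. This is how [19]² disposes of the signs in `θᴰ`.
    G-19 : G 38 (N ℕ.* 2) 19 * G⁺ 38 (N ℕ.* 2) 19 ≈ Q 38
    G-19 = begin
      G 38 (N ℕ.* 2) 19 * G⁺ 38 (N ℕ.* 2) 19               ≈⟨ ∏-* (N ℕ.* 2) _ _ ⟨
      ∏ (N ℕ.* 2) (λ i → (1# - y i) * (1# + y i))          ≈⟨ ∏-cong (N ℕ.* 2) (λ i → trans ([1-x][1+x] (y i)) (+-congˡ (-‿cong (y*y i)))) ⟩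
      G 76 (N ℕ.* 2) 38                                    ≈⟨ reflexive (≡.cong (λ n → G 76 n 38) N*2) ⟩
      G 76 (N ℕ.+ N) 38                                    ≈⟨ ∏-extend N N _ (λ i → 1-0≈1 (^-nilpotent qᴹ≈0 (M≤ i))) ⟩
      Q 38                                                 ∎
      where
      y : ℕ → Carrier
      y i = q ^ (19 ℕ.+ i ℕ.* 38)
      y*y : ∀ i → y i * y i ≈ q ^ (38 ℕ.+ i ℕ.* 76)
      y*y i = trans (sym (^-homo-* q (19 ℕ.+ i ℕ.* 38) (19 ℕ.+ i ℕ.* 38))) (^-congʳ q (exponent i))
        where
        exponent : ∀ i → 19 ℕ.+ i ℕ.* 38 ℕ.+ (19 ℕ.+ i ℕ.* 38) ≡ 38 ℕ.+ i ℕ.* 76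
        exponent = ℕ-solve-∀
      N*2 : N ℕ.* 2 ≡ N ℕ.+ N
      N*2 = ≡.trans (ℕ.*-comm N 2) (≡.cong (N ℕ.+_) (ℕ.+-identityʳ N))
      M≤ : ∀ i → M ℕ.≤ 38 ℕ.+ (N ℕ.+ i) ℕ.* 76
      M≤ i = ℕ.≤-trans (ℕ.m≤m*n M 2) (ℕ.≤-trans (ℕ.m≤m+n N i) (ℕ.≤-trans (ℕ.m≤m*n (N ℕ.+ i) 76) (ℕ.m≤n+m _ 38)))

    x r : Carrier
    x = s * q
    r = s * q ^ 18

    mon≈ : ∀ a b → mon x r a b ≈ s ^ (a ℕ.+ b) * q ^ (a ℕ.+ 18 ℕ.* b)
    mon≈ a b = begin
      (s * q) ^ a * (s * q ^ 18) ^ b                      ≈⟨ *-cong (^-distrib-* s q a) (^-distrib-* s (q ^ 18) b) ⟩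
      s ^ a * q ^ a * (s ^ b * (q ^ 18) ^ b)              ≈⟨ *-congˡ (*-congˡ (^-assocʳ q 18 b)) ⟩
      s ^ a * q ^ a * (s ^ b * q ^ (18 ℕ.* b))            ≈⟨ solve 4 (λ a b c d → a :* b :* (c :* d) := a :* c :* (b :* d)) refl _ _ _ _ ⟩
      s ^ a * s ^ b * (q ^ a * q ^ (18 ℕ.* b))            ≈⟨ *-cong (^-homo-* s a b) (^-homo-* q a (18 ℕ.* b)) ⟨
      s ^ (a ℕ.+ b) * q ^ (a ℕ.+ 18 ℕ.* b)                ∎

    mon-even : ∀ a b n → a ℕ.+ b ≡ n ℕ.* 2 → mon x r a b ≈ q ^ (a ℕ.+ 18 ℕ.* b)
    mon-even a b n e = trans (mon≈ a b) (trans (*-congʳ (trans (^-congʳ s e) (s^even n))) (*-identityˡ _))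

    mon-odd : ∀ a b n → a ℕ.+ b ≡ suc (n ℕ.* 2) → mon x r a b ≈ s * q ^ (a ℕ.+ 18 ℕ.* b)
    mon-odd a b n e = trans (mon≈ a b)
      (*-congʳ (trans (^-congʳ s e) (trans (*-congˡ (s^even n)) (*-identityʳ s))))

    nilpotent : ∀ {y} k → 1 ℕ.≤ k → y ≈ s * q ^ k → y ^ M ≈ 0#
    nilpotent {y} k@(suc _) _ h = begin
      y ^ M                          ≈⟨ ^-congˡ M h ⟩
      (s * q ^ k) ^ M                ≈⟨ ^-distrib-* s (q ^ k) M ⟩
      s ^ M * (q ^ k) ^ M            ≈⟨ *-congˡ (^-assocʳ q k M) ⟩
      s ^ M * q ^ (k ℕ.* M)          ≈⟨ *-congˡ (^-nilpotent qᴹ≈0 (ℕ.m≤n*m M k)) ⟩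
      s ^ M * 0#                     ≈⟨ zeroʳ _ ⟩
      0#                             ∎

    sq : Carrier → Carrier
    sq y = y * y

    -- The four thetas under x^a r^b ↦ q^(a+18b) up to sign: 37 = 1 + 36 and 39 = 3 + 36; 75 = 3 +
    -- 72 and 1; 18 and 20 = 2 + 18; 19 = 1 + 18 twice. In the last pair the arguments carry no
    -- minus sign, hence `G⁺`.
    θᴬ θᴮ θᶜ θᴰ : Carrier
    θᴬ = Q 39 * (Q 37 * Q 76)
    θᴮ = Q 1 * (Q 75 * Q 76)
    θᶜ = Q 20 * Q 58 * (Q 18 * Q 56 * (Q 38 * Q 76))
    θᴰ = G⁺ 38 (N ℕ.* 2) 19 * (G⁺ 38 (N ℕ.* 2) 19 * (Q 38 * Q 76))

    theta-squares : sq θᴬ ≈ q ^ 18 * sq θᴮ + θᶜ * θᴰ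
    theta-squares = begin
      sq θᴬ                                          ≈⟨ +-identityʳ _ ⟨
      sq θᴬ + 0#                                     ≈⟨ +-congˡ (trans (*-congʳ (-‿inverseˡ 1#)) (zeroˡ _)) ⟨
      sq θᴬ + (s + 1#) * (q ^ 18 * sq θᴮ)
        ≈⟨ solve 4 (λ a s p b → a :+ (s :+ con 1) :* (p :* b) := p :* b :+ (a :+ s :* p :* b)) refl _ _ _ _ ⟩
      q ^ 18 * sq θᴮ + (sq θᴬ + s * q ^ 18 * sq θᴮ)
        ≈⟨ +-congˡ (+-cong (*-cong A A) (*-cong (mon-odd 0 1 0 ≡.refl) (*-cong B B))) ⟨
      q ^ 18 * sq θᴮ + (sq (theta N (mon x r 1 2) (mon x r 3 2)) + mon x r 0 1 * sq (theta N (mon x r 3 4) (mon x r 1 0)))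
        ≈⟨ +-congˡ (theta-identity x r M N
             (nilpotent 1 (ℕ.s≤s ℕ.z≤n) (*-congˡ (sym (*-identityʳ q)))) (nilpotent 18 (ℕ.s≤s ℕ.z≤n) refl) ℕ.≤-refl) ⟩
      q ^ 18 * sq θᴮ + theta (N ℕ.* 2) (mon x r 0 1) (mon x r 2 1) * theta (N ℕ.* 2) (mon x r 1 1) (mon x r 1 1)
        ≈⟨ +-congˡ (*-cong C D) ⟩
      q ^ 18 * sq θᴮ + θᶜ * θᴰ                       ∎
      where
      A : theta N (mon x r 1 2) (mon x r 3 2) ≈ θᴬ
      A = theta⁻ N 37 39 (mon-odd 1 2 1 ≡.refl) (mon-odd 3 2 2 ≡.refl)
      B : theta N (mon x r 3 4) (mon x r 1 0) ≈ θᴮ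
      B = theta⁻ N 75 1 (mon-odd 3 4 3 ≡.refl) (mon-odd 1 0 0 ≡.refl)
      C : theta (N ℕ.* 2) (mon x r 0 1) (mon x r 2 1) ≈ θᶜ
      C = trans (theta⁻ (N ℕ.* 2) 18 20 (mon-odd 0 1 0 ≡.refl) (mon-odd 2 1 1 ≡.refl))
            (*-cong (G-halve 20) (*-cong (G-halve 18) (G-halve 38)))
      D : theta (N ℕ.* 2) (mon x r 1 1) (mon x r 1 1) ≈ θᴰ
      D = trans (theta⁺ (N ℕ.* 2) 19 19 (mon-even 1 1 1 ≡.refl) (mon-even 1 1 1 ≡.refl))
            (*-congˡ (*-congˡ (G-halve 38)))

    product-identity :
      sq (Q 37 * Q 39) * sq (Q 19 * Q 57) * sq (Q 76) ≈
      q ^ 18 * (sq (Q 1 * Q 75) * sq (Q 19 * Q 57) * sq (Q 76)) +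
      Q 18 * Q 58 * (Q 20 * Q 56) * sq (Q 38 * Q 38) * sq (Q 76)
    product-identity = begin
      sq (Q 37 * Q 39) * sq (Q 19 * Q 57) * sq (Q 76)
        ≈⟨ solve 5 (λ a b c d e → (a :* b) :* (a :* b) :* ((c :* d) :* (c :* d)) :* (e :* e) :=
             (b :* (a :* e)) :* (b :* (a :* e)) :* ((c :* d) :* (c :* d))) refl (Q 37) (Q 39) (Q 19) (Q 57) (Q 76) ⟩
      sq θᴬ * sq (Q 19 * Q 57)
        ≈⟨ *-congʳ theta-squares ⟩
      (q ^ 18 * sq θᴮ + θᶜ * θᴰ) * sq (Q 19 * Q 57)
        ≈⟨ distribʳ _ _ _ ⟩
      q ^ 18 * sq θᴮ * sq (Q 19 * Q 57) + θᶜ * θᴰ * sq (Q 19 * Q 57)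
        ≈⟨ +-cong
           (sym (solve 6 (λ p a b c d e → p :* ((a :* (b :* e)) :* (a :* (b :* e))) :* ((c :* d) :* (c :* d)) :=
             p :* ((a :* b) :* (a :* b) :* ((c :* d) :* (c :* d)) :* (e :* e)))
             refl (q ^ 18) (Q 1) (Q 75) (Q 19) (Q 57) (Q 76)))
           (*-congˡ (*-cong (G-halve 19) (G-halve 19))) ⟨
      q ^ 18 * (sq (Q 1 * Q 75) * sq (Q 19 * Q 57) * sq (Q 76)) + θᶜ * θᴰ * sq (G 38 (N ℕ.* 2) 19)
        ≈⟨ +-congˡ (solve 8 (λ a b c d e f h g →
             (a :* b :* (c :* d :* (e :* f))) :* (h :* (h :* (e :* f))) :* (g :* g) :=
             c :* b :* (a :* d) :* ((e :* (g :* h)) :* (e :* (g :* h))) :* (f :* f))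
             refl (Q 20) (Q 58) (Q 18) (Q 56) (Q 38) (Q 76) (G⁺ 38 (N ℕ.* 2) 19) (G 38 (N ℕ.* 2) 19)) ⟩
      q ^ 18 * (sq (Q 1 * Q 75) * sq (Q 19 * Q 57) * sq (Q 76)) +
      Q 18 * Q 58 * (Q 20 * Q 56) * sq (Q 38 * (G 38 (N ℕ.* 2) 19 * G⁺ 38 (N ℕ.* 2) 19)) * sq (Q 76)
        ≈⟨ +-congˡ (*-congʳ (*-congˡ (*-cong (*-congˡ G-19) (*-congˡ G-19)))) ⟩
      q ^ 18 * (sq (Q 1 * Q 75) * sq (Q 19 * Q 57) * sq (Q 76)) +
      Q 18 * Q 58 * (Q 20 * Q 56) * sq (Q 38 * Q 38) * sq (Q 76) ∎

-- Reciprocals of products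

-- Residues are represented by 1, ..., t instead of 0, ..., t - 1, so that the numbers a + i t with
-- i ≥ 0 are the positive sizes, each once.
colouredSizes : (ℕ → ℕ) → ℕ → List ℕ
colouredSizes c t = concatMap (λ a → replicate (c a) a) (applyUpTo suc t)

periodic-* : ∀ {c : ℕ → ℕ} {t} → (∀ m → c (t ℕ.+ m) ≡ c m) → ∀ i m → c (m ℕ.+ i ℕ.* t) ≡ c m
periodic-* {c} {t} h zero    m = ≡.cong c (ℕ.+-identityʳ m)
periodic-* {c} {t} h (suc i) m = ≡.trans (≡.cong c rearrange) (≡.trans (h (m ℕ.+ i ℕ.* t)) (periodic-* h i m))
  where
  rearrange : m ℕ.+ (t ℕ.+ i ℕ.* t) ≡ t ℕ.+ (m ℕ.+ i ℕ.* t)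
  rearrange = ≡.trans (≡.sym (ℕ.+-assoc m t _)) (≡.trans (≡.cong (ℕ._+ i ℕ.* t) (ℕ.+-comm m t)) (ℕ.+-assoc t m _))

module ListProducts {c ℓ} (R : CommutativeRing c ℓ) where
  open CommutativeRing R
  open import Relation.Binary.Reasoning.Setoid setoid
  open import Algebra.Properties.Semiring.Exp semiring
  open RingLemmas R

  ∏ᴸ : (ℕ → Carrier) → List ℕ → Carrier
  ∏ᴸ f = foldr (λ a p → f a * p) 1#

  ∏ᴸ-replicate : ∀ f n a as → ∏ᴸ f (replicate n a ++ as) ≈ f a ^ n * ∏ᴸ f as
  ∏ᴸ-replicate f zero    a as = sym (*-identityˡ _)
  ∏ᴸ-replicate f (suc n) a as = trans (*-congˡ (∏ᴸ-replicate f n a as)) (sym (*-assoc _ _ _))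

  ∏-power : ∀ f (c h : ℕ → ℕ) n →
    ∏ n (λ k → f (h k) ^ c (h k)) ≈ ∏ᴸ f (concatMap (λ a → replicate (c a) a) (applyUpTo h n))
  ∏-power f c h zero    = refl
  ∏-power f c h (suc n) = trans (*-congˡ (∏-power f c (λ k → h (suc k)) n)) (sym (∏ᴸ-replicate f (c (h 0)) (h 0) _))

  ∏-∏ᴸ : ∀ n (f : ℕ → ℕ → Carrier) as → ∏ n (λ i → ∏ᴸ (f i) as) ≈ ∏ᴸ (λ a → ∏ n (λ i → f i a)) as
  ∏-∏ᴸ n f []       = ∏-1 n λ _ → refl
  ∏-∏ᴸ n f (a ∷ as) = trans (∏-* n _ _) (*-congˡ (∏-∏ᴸ n f as))

  -- The recurrence of a series P m j counting partitions into parts of size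
  -- below m, or equal to m and among its first j colours.
  record Counts (q : Carrier) (c : ℕ → ℕ) (P : ℕ → ℕ → Carrier) : Set ℓ where
    field
      P-zero : ∀ j → P 0 j ≈ 1#
      P-suc  : ∀ m → P (suc m) 0 ≈ P m (c m)
      P-step : ∀ m j → P (suc m) (suc j) ≈ P (suc m) j + q ^ suc m * P (suc m) (suc j)

  module _ {q c P} (counts : Counts q c P) where
    open Counts counts

    -- Solved for its unknown, `P-step` reads (1 - q^(m+1)) P(m+1, j+1) = P(m+1, j): each colour
    -- contributes one geometric series.
    P-clear : ∀ m j → (1# - q ^ suc m) ^ j * P (suc m) j ≈ P m (c m)
    P-clear m zero    = trans (*-identityˡ _) (P-suc m)
    P-clear m (suc j) = begin
      (1# - y) * (1# - y) ^ j * p              ≈⟨ *-congʳ (*-comm _ _) ⟩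
      (1# - y) ^ j * (1# - y) * p              ≈⟨ *-assoc _ _ _ ⟩
      (1# - y) ^ j * ((1# - y) * p)            ≈⟨ *-congˡ [1-y]p≈p′ ⟩
      (1# - y) ^ j * p′                        ≈⟨ P-clear m j ⟩
      P m (c m)                                ∎
      where
      y p p′ : Carrier
      y  = q ^ suc m
      p  = P (suc m) (suc j)
      p′ = P (suc m) j
      [1-y]p≈p′ : (1# - y) * p ≈ p′
      [1-y]p≈p′ = begin
        (1# - y) * p                 ≈⟨ distribʳ p 1# (- y) ⟩
        1# * p + - y * p             ≈⟨ +-congʳ (trans (*-identityˡ p) (P-step m j)) ⟩
        p′ + y * p + - y * p         ≈⟨ +-assoc _ _ _ ⟩
        p′ + (y * p + - y * p)       ≈⟨ +-congˡ (distribʳ p y (- y)) ⟨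
        p′ + (y - y) * p             ≈⟨ +-congˡ (trans (*-congʳ (-‿inverseʳ y)) (zeroˡ p)) ⟩
        p′ + 0#                      ≈⟨ +-identityʳ p′ ⟩
        p′                           ∎

    P-product : ∀ m → ∏ m (λ i → (1# - q ^ suc i) ^ c (suc i)) * P m (c m) ≈ 1#
    P-product zero    = trans (*-identityˡ _) (P-zero (c 0))
    P-product (suc m) = begin
      ∏ (suc m) f * P (suc m) (c (suc m))      ≈⟨ *-congʳ (∏-last m f) ⟩
      ∏ m f * f m * P (suc m) (c (suc m))      ≈⟨ *-assoc _ _ _ ⟩
      ∏ m f * (f m * P (suc m) (c (suc m)))    ≈⟨ *-congˡ (P-clear m (c (suc m))) ⟩
      ∏ m f * P m (c m)                        ≈⟨ P-product m ⟩
      1#                                       ∎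
      where
      f : ℕ → Carrier
      f i = (1# - q ^ suc i) ^ c (suc i)

    -- Sizes up to nt are sorted by residue; periodicity of the colours makes each residue class a
    -- product over one progression, repeated once for each of its colours.
    P-periodic : ∀ t n → (∀ m → c (t ℕ.+ m) ≡ c m) →
      ∏ᴸ (λ a → ∏ n (λ i → 1# - q ^ (a ℕ.+ i ℕ.* t))) (colouredSizes c t) * P (n ℕ.* t) (c (n ℕ.* t)) ≈ 1#
    P-periodic t n h = begin
      ∏ᴸ (λ a → ∏ n (λ i → 1# - q ^ (a ℕ.+ i ℕ.* t))) (colouredSizes c t) * p
        ≈⟨ *-congʳ (∏-∏ᴸ n (λ i a → 1# - q ^ (a ℕ.+ i ℕ.* t)) (colouredSizes c t)) ⟨
      ∏ n (λ i → ∏ᴸ (λ a → 1# - q ^ (a ℕ.+ i ℕ.* t)) (colouredSizes c t)) * p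
        ≈⟨ *-congʳ (∏-cong n (λ i → ∏-power (λ a → 1# - q ^ (a ℕ.+ i ℕ.* t)) c suc t)) ⟨
      ∏ n (λ i → ∏ t (λ k → (1# - q ^ (suc k ℕ.+ i ℕ.* t)) ^ c (suc k))) * p
        ≈⟨ *-congʳ (∏-cong n (λ i → ∏-cong t (λ k →
             ^-congʳ (1# - q ^ (suc k ℕ.+ i ℕ.* t)) (≡.sym (periodic-* h i (suc k)))))) ⟩
      ∏ n (λ i → ∏ t (λ k → f (k ℕ.+ i ℕ.* t))) * p
        ≈⟨ *-congʳ (∏-blocks n t f) ⟨
      ∏ (n ℕ.* t) f * p
        ≈⟨ P-product (n ℕ.* t) ⟩
      1# ∎
      where
      p : Carrier
      p = P (n ℕ.* t) (c (n ℕ.* t))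
      f : ℕ → Carrier
      f i = (1# - q ^ suc i) ^ c (suc i)

module Reciprocals {c ℓ} (R : CommutativeRing c ℓ) (q : CommutativeRing.Carrier R) (M : ℕ) where
  open CommutativeRing R
  open import Relation.Binary.Reasoning.Setoid setoid
  open import Algebra.Properties.Semiring.Exp semiring
  open import Algebra.Solver.Ring.NaturalCoefficients.Default commutativeSemiring
    using (solve; _:=_; _:+_; _:*_; con)
  open ListProducts R
  open ProductIdentity R q M

  -- In the application a = [1], b = [37], e = [19], u = [18] [20] [38]², d = (q^76; q^76)_∞ and p =
  -- q^18. The conclusion is the hypothesis divided by a² b² e² u d², where the division is
  -- multiplication by the given inverses; k₀ takes care of d.
  cross-multiply : ∀ {a b e u d p k₁ k₂ k₃ k₀} →
    b * b * (e * e) * (d * d) ≈ p * (a * a * (e * e) * (d * d)) + u * (d * d) →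
    u * (a * a) * k₁ ≈ 1# → u * (b * b) * k₂ ≈ 1# → a * a * (e * e) * (b * b) * k₃ ≈ 1# → d * k₀ ≈ 1# →
    k₁ ≈ p * k₂ + k₃
  cross-multiply {a} {b} {e} {u} {d} {p} {k₁} {k₂} {k₃} {k₀} h h₁ h₂ h₃ h₀ = begin
    k₁
      ≈⟨ trans (*-congˡ (unit h₂ h₃)) (*-identityʳ k₁) ⟨
    k₁ * (e₂ * k₂ * (e₃ * k₃) * (d * k₀ * (d * k₀)))
      ≈⟨ solve 9 (λ a b e u d k₁ k₂ k₃ k₀ →
           k₁ :* (u :* (b :* b) :* k₂ :* (a :* a :* (e :* e) :* (b :* b) :* k₃) :* (d :* k₀ :* (d :* k₀))) :=
           k₁ :* k₂ :* k₃ :* k₀ :* k₀ :* u :* a :* a :* b :* b :* (b :* b :* (e :* e) :* (d :* d)))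
           refl a b e u d k₁ k₂ k₃ k₀ ⟩
    k₁ * k₂ * k₃ * k₀ * k₀ * u * a * a * b * b * (b * b * (e * e) * (d * d))
      ≈⟨ *-congˡ h ⟩
    k₁ * k₂ * k₃ * k₀ * k₀ * u * a * a * b * b * (p * (a * a * (e * e) * (d * d)) + u * (d * d))
      ≈⟨ solve 10 (λ a b e u d k₁ k₂ k₃ k₀ p →
           k₁ :* k₂ :* k₃ :* k₀ :* k₀ :* u :* a :* a :* b :* b :* (p :* (a :* a :* (e :* e) :* (d :* d)) :+ u :* (d :* d)) :=
           p :* (k₂ :* (u :* (a :* a) :* k₁ :* (a :* a :* (e :* e) :* (b :* b) :* k₃) :* (d :* k₀ :* (d :* k₀)))) :+
           k₃ :* (u :* (a :* a) :* k₁ :* (u :* (b :* b) :* k₂) :* (d :* k₀ :* (d :* k₀))))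
           refl a b e u d k₁ k₂ k₃ k₀ p ⟩
    p * (k₂ * (e₁ * k₁ * (e₃ * k₃) * (d * k₀ * (d * k₀)))) + k₃ * (e₁ * k₁ * (e₂ * k₂) * (d * k₀ * (d * k₀)))
      ≈⟨ +-cong (*-congˡ (trans (*-congˡ (unit h₁ h₃)) (*-identityʳ k₂))) (trans (*-congˡ (unit h₁ h₂)) (*-identityʳ k₃)) ⟩
    p * k₂ + k₃ ∎
    where
    e₁ e₂ e₃ : Carrier
    e₁ = u * (a * a)
    e₂ = u * (b * b)
    e₃ = a * a * (e * e) * (b * b)
    unit : ∀ {x y} → x ≈ 1# → y ≈ 1# → x * y * (d * k₀ * (d * k₀)) ≈ 1#
    unit hx hy = trans (*-cong (trans (*-cong hx hy) (*-identityˡ 1#))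
                               (trans (*-cong h₀ h₀) (*-identityˡ 1#))) (*-identityˡ 1#)

  -- The lists are the values of `colouredSizes` for the three colourings and for the multiples of
  -- 76. The entry 38 occurs four times because 38 and -38 each grant it two colours.
  reciprocals : q ^ M ≈ 0# → ∀ {k₁ k₂ k₃ k₀} →
    ∏ᴸ Q (1 ∷ 1 ∷ 18 ∷ 20 ∷ 38 ∷ 38 ∷ 38 ∷ 38 ∷ 56 ∷ 58 ∷ 75 ∷ 75 ∷ []) * k₁ ≈ 1# →
    ∏ᴸ Q (18 ∷ 20 ∷ 37 ∷ 37 ∷ 38 ∷ 38 ∷ 38 ∷ 38 ∷ 39 ∷ 39 ∷ 56 ∷ 58 ∷ []) * k₂ ≈ 1# →
    ∏ᴸ Q (1 ∷ 1 ∷ 19 ∷ 19 ∷ 37 ∷ 37 ∷ 39 ∷ 39 ∷ 57 ∷ 57 ∷ 75 ∷ 75 ∷ []) * k₃ ≈ 1# →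
    ∏ᴸ Q (76 ∷ []) * k₀ ≈ 1# →
    k₁ ≈ q ^ 18 * k₂ + k₃
  reciprocals qᴹ≈0 h₁ h₂ h₃ h₀ = cross-multiply (product-identity qᴹ≈0)
    (trans (*-congʳ (solve 7 (λ a b c d e f g →
      (a :* b :* (c :* d)) :* ((e :* e) :* (e :* e)) :* ((f :* g) :* (f :* g)) :=
      f :* (f :* (a :* (c :* (e :* (e :* (e :* (e :* (d :* (b :* (g :* (g :* con 1))))))))))))
      refl (Q 18) (Q 58) (Q 20) (Q 56) (Q 38) (Q 1) (Q 75))) h₁)
    (trans (*-congʳ (solve 7 (λ a b c d e f g →
      (a :* b :* (c :* d)) :* ((e :* e) :* (e :* e)) :* ((f :* g) :* (f :* g)) :=
      a :* (c :* (f :* (f :* (e :* (e :* (e :* (e :* (g :* (g :* (d :* (b :* con 1))))))))))))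
      refl (Q 18) (Q 58) (Q 20) (Q 56) (Q 38) (Q 37) (Q 39))) h₂)
    (trans (*-congʳ (solve 6 (λ a b c d e f →
      ((a :* b) :* (a :* b)) :* ((c :* d) :* (c :* d)) :* ((e :* f) :* (e :* f)) :=
      a :* (a :* (c :* (c :* (e :* (e :* (f :* (f :* (d :* (d :* (b :* (b :* con 1))))))))))))
      refl (Q 1) (Q 75) (Q 19) (Q 57) (Q 37) (Q 39))) h₃)
    (trans (*-congʳ (sym (*-identityʳ (Q 76)))) h₀)

-- Truncated power series

open import Data.Integer.Base using (_-_; 0ℤ)

Series : Set
Series = ℕ → ℤ

infixl 6 _⊕_
infixl 7 _⊛_

_⊕_ : Series → Series → Series
(f ⊕ g) n = f n ℤ.+ g n

tail : Series → Series
tail f n = f (suc n)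

_⊛_ : Series → Series → Series
(f ⊛ g) zero    = f 0 ℤ.* g 0
(f ⊛ g) (suc n) = f 0 ℤ.* g (suc n) ℤ.+ (tail f ⊛ g) n

one : Series
one zero    = + 1
one (suc n) = 0ℤ

var : Series
var zero    = 0ℤ
var (suc n) = one n

⊛-cong : ∀ n {f f′ g g′} → (∀ k → k ≤ n → f k ≡ f′ k) → (∀ k → k ≤ n → g k ≡ g′ k) → (f ⊛ g) n ≡ (f′ ⊛ g′) n
⊛-cong zero    hf hg = ≡.cong₂ ℤ._*_ (hf 0 ℕ.z≤n) (hg 0 ℕ.z≤n)
⊛-cong (suc n) hf hg = ≡.cong₂ ℤ._+_ (≡.cong₂ ℤ._*_ (hf 0 ℕ.z≤n) (hg (suc n) ℕ.≤-refl))
  (⊛-cong n (λ k k≤n → hf (suc k) (ℕ.s≤s k≤n)) (λ k k≤n → hg k (ℕ.m≤n⇒m≤1+n k≤n)))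

⊛-distribʳ : ∀ f g h n → ((f ⊕ g) ⊛ h) n ≡ (f ⊛ h) n ℤ.+ (g ⊛ h) n
⊛-distribʳ f g h zero    = ℤ.*-distribʳ-+ (h 0) (f 0) (g 0)
⊛-distribʳ f g h (suc n) = ≡.trans
  (≡.cong (λ z → (f 0 ℤ.+ g 0) ℤ.* h (suc n) ℤ.+ z) (⊛-distribʳ (tail f) (tail g) h n))
  (rearrange (f 0) (g 0) (h (suc n)) _ _)
  where
  rearrange : ∀ a b c d e → (a ℤ.+ b) ℤ.* c ℤ.+ (d ℤ.+ e) ≡ a ℤ.* c ℤ.+ d ℤ.+ (b ℤ.* c ℤ.+ e)
  rearrange = ℤ-solve-∀

⊛-scale : ∀ a f g n → ((λ k → a ℤ.* f k) ⊛ g) n ≡ a ℤ.* (f ⊛ g) n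
⊛-scale a f g zero    = ℤ.*-assoc a (f 0) (g 0)
⊛-scale a f g (suc n) = ≡.trans
  (≡.cong (λ z → a ℤ.* f 0 ℤ.* g (suc n) ℤ.+ z) (⊛-scale a (tail f) g n))
  (rearrange a (f 0) (g (suc n)) _)
  where
  rearrange : ∀ a b c d → a ℤ.* b ℤ.* c ℤ.+ a ℤ.* d ≡ a ℤ.* (b ℤ.* c ℤ.+ d)
  rearrange = ℤ-solve-∀

⊛-assoc : ∀ f g h n → ((f ⊛ g) ⊛ h) n ≡ (f ⊛ (g ⊛ h)) n
⊛-assoc f g h zero    = ℤ.*-assoc (f 0) (g 0) (h 0)
⊛-assoc f g h (suc n) = begin
  f 0 ℤ.* g 0 ℤ.* h (suc n) ℤ.+ (((λ k → f 0 ℤ.* g (suc k)) ⊕ (tail f ⊛ g)) ⊛ h) n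
    ≡⟨ ≡.cong (λ z → f 0 ℤ.* g 0 ℤ.* h (suc n) ℤ.+ z) (≡.trans
         (⊛-distribʳ (λ k → f 0 ℤ.* g (suc k)) (tail f ⊛ g) h n)
         (≡.cong₂ ℤ._+_ (⊛-scale (f 0) (tail g) h n) (⊛-assoc (tail f) g h n))) ⟩
  f 0 ℤ.* g 0 ℤ.* h (suc n) ℤ.+ (f 0 ℤ.* (tail g ⊛ h) n ℤ.+ (tail f ⊛ (g ⊛ h)) n)
    ≡⟨ rearrange (f 0) (g 0) (h (suc n)) _ _ ⟩
  f 0 ℤ.* (g 0 ℤ.* h (suc n) ℤ.+ (tail g ⊛ h) n) ℤ.+ (tail f ⊛ (g ⊛ h)) n ∎
  where
  open ≡.≡-Reasoning
  rearrange : ∀ a b c d e → a ℤ.* b ℤ.* c ℤ.+ (a ℤ.* d ℤ.+ e) ≡ a ℤ.* (b ℤ.* c ℤ.+ d) ℤ.+ e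
  rearrange = ℤ-solve-∀

⊛-zeroˡ : ∀ f n → ((λ _ → 0ℤ) ⊛ f) n ≡ 0ℤ
⊛-zeroˡ f zero    = ≡.refl
⊛-zeroˡ f (suc n) = ≡.trans (ℤ.+-identityˡ _) (⊛-zeroˡ f n)

⊛-identityˡ : ∀ f n → (one ⊛ f) n ≡ f n
⊛-identityˡ f zero    = ℤ.*-identityˡ (f 0)
⊛-identityˡ f (suc n) = ≡.trans
  (≡.cong₂ ℤ._+_ (ℤ.*-identityˡ (f (suc n))) (⊛-zeroˡ f n)) (ℤ.+-identityʳ _)

-- The defining recursion peels the first argument only; this mirror image for the second one is
-- what commutativity needs.
⊛-sucʳ : ∀ f g n → (f ⊛ g) (suc n) ≡ (f ⊛ tail g) n ℤ.+ f (suc n) ℤ.* g 0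
⊛-sucʳ f g zero    = ≡.refl
⊛-sucʳ f g (suc n) = ≡.trans
  (≡.cong (λ z → f 0 ℤ.* g (suc (suc n)) ℤ.+ z) (⊛-sucʳ (tail f) g n)) 
  (≡.sym (ℤ.+-assoc (f 0 ℤ.* g (suc (suc n))) ((tail f ⊛ tail g) n) (f (suc (suc n)) ℤ.* g 0)))

⊛-comm : ∀ f g n → (f ⊛ g) n ≡ (g ⊛ f) n
⊛-comm f g zero    = ℤ.*-comm (f 0) (g 0)
⊛-comm f g (suc n) = begin
  f 0 ℤ.* g (suc n) ℤ.+ (tail f ⊛ g) n   ≡⟨ ≡.cong₂ ℤ._+_ (ℤ.*-comm (f 0) (g (suc n))) (⊛-comm (tail f) g n) ⟩
  g (suc n) ℤ.* f 0 ℤ.+ (g ⊛ tail f) n   ≡⟨ ℤ.+-comm (g (suc n) ℤ.* f 0) ((g ⊛ tail f) n) ⟩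
  (g ⊛ tail f) n ℤ.+ g (suc n) ℤ.* f 0   ≡⟨ ⊛-sucʳ g f n ⟨
  (g ⊛ f) (suc n)                        ∎
  where open ≡.≡-Reasoning

var-⊛-suc : ∀ f n → (var ⊛ f) (suc n) ≡ f n
var-⊛-suc f n = ≡.trans (ℤ.+-identityˡ _) (⊛-identityˡ f n)

infix 4 _≈[_]_

-- Equality modulo q^M. As a record it lets f, M and g be recovered from the type.
record _≈[_]_ (f : Series) (M : ℕ) (g : Series) : Set where
  constructor agree
  field coefficient : ∀ n → n ℕ.< M → f n ≡ g n
open _≈[_]_

pointwise : ∀ {M f g} → (∀ n → f n ≡ g n) → f ≈[ M ] g
pointwise h = agree λ n _ → h n

truncatedSeries : ℕ → CommutativeRing 0ℓ 0ℓ
truncatedSeries M = record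
  { Carrier = Series
  ; _≈_     = _≈[ M ]_
  ; _+_     = _⊕_
  ; _*_     = _⊛_
  ; -_      = λ f n → ℤ.- f n
  ; 0#      = λ _ → 0ℤ
  ; 1#      = one
  ; isCommutativeRing = record
    { isRing = record
      { +-isAbelianGroup = record
        { isGroup = record
          { isMonoid = record
            { isSemigroup = record
              { isMagma = record
                { isEquivalence = record
                  { refl  = pointwise λ _ → ≡.refl
                  ; sym   = λ (agree p) → agree λ n h → ≡.sym (p n h)
                  ; trans = λ (agree p) (agree q) → agree λ n h → ≡.trans (p n h) (q n h)
                  }
                ; ∙-cong = λ (agree p) (agree q) → agree λ n h → ≡.cong₂ ℤ._+_ (p n h) (q n h)
                }
              ; assoc = λ f g h → pointwise λ n → ℤ.+-assoc (f n) (g n) (h n)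
              }
            ; identity = (λ f → pointwise λ n → ℤ.+-identityˡ (f n)) , (λ f → pointwise λ n → ℤ.+-identityʳ (f n))
            }
          ; inverse = (λ f → pointwise λ n → ℤ.+-inverseˡ (f n)) , (λ f → pointwise λ n → ℤ.+-inverseʳ (f n))
          ; ⁻¹-cong = λ (agree p) → agree λ n h → ≡.cong ℤ.-_ (p n h)
          }
        ; comm = λ f g → pointwise λ n → ℤ.+-comm (f n) (g n)
        }
      ; *-cong     = λ (agree p) (agree q) → agree λ n h →
                       ⊛-cong n (λ k k≤n → p k (ℕ.≤-<-trans k≤n h)) (λ k k≤n → q k (ℕ.≤-<-trans k≤n h))
      ; *-assoc    = λ f g h → pointwise (⊛-assoc f g h)
      ; *-identity = (λ f → pointwise (⊛-identityˡ f)) ,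
                     (λ f → pointwise λ n → ≡.trans (⊛-comm f one n) (⊛-identityˡ f n))
      ; distrib    = (λ f g h → pointwise λ n → ≡.trans (⊛-comm f (g ⊕ h) n) (≡.trans (⊛-distribʳ g h f n)
                       (≡.cong₂ ℤ._+_ (⊛-comm g f n) (⊛-comm h f n)))) ,
                     (λ f g h → pointwise (⊛-distribʳ g h f))
      }
    ; *-comm = λ f g → pointwise (⊛-comm f g)
    }
  }

-- The enumerated partitions as power series

open Enumeration

-- Removing a part lowers the fuel by 1 but the total by the size of the part, so the recursion
-- leaves the diagonal f = n on which `belowSeries` is defined. Any sufficient fuel yields the same
-- list, which brings it back.
below-fuel : ∀ c m j f f′ n → n ≤ f → n ≤ f′ → below c m j f n ≡ below c m j f′ n
below-fuel c zero    j       f       f′       zero    h h′ = ≡.refl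
below-fuel c zero    j       f       f′       (suc n) h h′ = ≡.refl
below-fuel c (suc m) zero    f       f′       n       h h′ = ≡.refl
below-fuel c (suc m) (suc j) zero    zero     n       h h′ = ≡.refl
below-fuel c (suc m) (suc j) zero    (suc f′) zero    h h′ = below-fuel c (suc m) j zero (suc f′) 0 h h′
below-fuel c (suc m) (suc j) (suc f) zero     zero    h h′ = below-fuel c (suc m) j (suc f) zero 0 h h′
below-fuel c (suc m) (suc j) (suc f) (suc f′) n       h h′ with suc m ℕ.≤? n
... | no  _ = below-fuel c (suc m) j (suc f) (suc f′) n h h′
... | yes _ = ≡.cong₂ (λ xs ys → xs ++ map ((suc m , j) ∷_) ys)
  (below-fuel c (suc m) j (suc f) (suc f′) n h h′)
  (below-fuel c (suc m) (suc j) f f′ (n ∸ suc m) (fuel h) (fuel h′))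

belowSeries : Colouring → ℕ → ℕ → Series
belowSeries c m j n = + length (below c m j n n)

belowSeries-< : ∀ c m j n → n ℕ.< suc m → belowSeries c (suc m) (suc j) n ≡ belowSeries c (suc m) j n
belowSeries-< c m j zero    h = ≡.refl
belowSeries-< c m j (suc n) h with suc m ℕ.≤? suc n
... | no  _ = ≡.refl
... | yes p = contradiction p (ℕ.<⇒≱ h)

-- A partition either avoids the coloured part `(suc m , j)` or is obtained by adding one copy of
-- it.
belowSeries-≥ : ∀ c m j n → belowSeries c (suc m) (suc j) (suc m ℕ.+ n) ≡
                      belowSeries c (suc m) j (suc m ℕ.+ n) ℤ.+ belowSeries c (suc m) (suc j) n
belowSeries-≥ c m j n with suc m ℕ.≤? suc m ℕ.+ n
... | no  p = contradiction (ℕ.m≤m+n (suc m) n) p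
... | yes _ = ≡.cong +_ (≡.trans (length-++ (below c (suc m) j (suc m ℕ.+ n) (suc m ℕ.+ n)))
  (≡.cong (length (below c (suc m) j (suc m ℕ.+ n) (suc m ℕ.+ n)) ℕ.+_)
  (≡.trans (length-map ((suc m , j) ∷_) (below c (suc m) (suc j) (m ℕ.+ n) (m ℕ.+ n ∸ m)))
  (≡.cong length (≡.trans (≡.cong (below c (suc m) (suc j) (m ℕ.+ n)) (ℕ.m+n∸m≡n m n))
    (below-fuel c (suc m) (suc j) (m ℕ.+ n) n n (ℕ.m≤n+m n m) ℕ.≤-refl))))))

-- Sizes above n cannot occur in a partition of n. For k = 0 both sides are the same list length by
-- definition.
belowSeries-stable : ∀ c k n → belowSeries c (k ℕ.+ n) (c (k ℕ.+ n)) n ≡ + #partitions c n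
belowSeries-stable c zero    n = ≡.refl
belowSeries-stable c (suc k) n = ≡.trans (drop-colours (c (suc k ℕ.+ n))) (belowSeries-stable c k n)
  where
  drop-colours : ∀ j → belowSeries c (suc k ℕ.+ n) j n ≡ belowSeries c (suc k ℕ.+ n) 0 n
  drop-colours zero    = ≡.refl
  drop-colours (suc j) = ≡.trans (belowSeries-< c (k ℕ.+ n) j n (ℕ.s≤s (ℕ.m≤n+m n k))) (drop-colours j)

gf : Colouring → Series
gf c n = + #partitions c n

module Truncated (M : ℕ) where
  open CommutativeRing (truncatedSeries M) using (_≈_; 0#; semiring)
  open import Algebra.Properties.Semiring.Exp semiring public using (_^_)
  open ListProducts (truncatedSeries M)

  var^-⊛-≥ : ∀ k f n → ((var ^ k) ⊛ f) (k ℕ.+ n) ≡ f n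
  var^-⊛-≥ zero    f n = ⊛-identityˡ f n
  var^-⊛-≥ (suc k) f n = ≡.trans (⊛-assoc var (var ^ k) f (suc k ℕ.+ n))
    (≡.trans (var-⊛-suc (var ^ k ⊛ f) (k ℕ.+ n)) (var^-⊛-≥ k f n))

  var^-⊛-< : ∀ k f n → n ℕ.< k → ((var ^ k) ⊛ f) n ≡ 0ℤ
  var^-⊛-< (suc k) f zero    _         = ⊛-assoc var (var ^ k) f 0
  var^-⊛-< (suc k) f (suc n) (ℕ.s≤s h) = ≡.trans (⊛-assoc var (var ^ k) f (suc n))
    (≡.trans (var-⊛-suc (var ^ k ⊛ f) n) (var^-⊛-< k f n h))

  var^M≈0 : var ^ M ≈ 0#
  var^M≈0 = agree λ n h → ≡.trans (≡.sym (≡.trans (⊛-comm (var ^ M) one n) (⊛-identityˡ (var ^ M) n))) (var^-⊛-< M one n h)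

  belowSeries-counts : ∀ c → Counts var c (belowSeries c)
  belowSeries-counts c = record
    { P-zero = λ j → pointwise λ { zero → ≡.refl ; (suc n) → ≡.refl }
    ; P-suc  = λ m → pointwise λ n → ≡.refl
    ; P-step = λ m j → pointwise (step m j)
    }
    where
    step : ∀ m j n → belowSeries c (suc m) (suc j) n ≡ belowSeries c (suc m) j n ℤ.+ (var ^ suc m ⊛ belowSeries c (suc m) (suc j)) n
    step m j n with suc m ℕ.≤? n
    ... | no p = ≡.trans (belowSeries-< c m j n (ℕ.≰⇒> p)) (≡.sym (≡.trans
      (≡.cong (λ z → belowSeries c (suc m) j n ℤ.+ z) (var^-⊛-< (suc m) (belowSeries c (suc m) (suc j)) n (ℕ.≰⇒> p))) (ℤ.+-identityʳ _)))
    ... | yes p with k , ≡.refl ← ℕ.m≤n⇒∃[o]m+o≡n p =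
      ≡.trans (belowSeries-≥ c m j k) (≡.cong (λ z → belowSeries c (suc m) j (suc m ℕ.+ k) ℤ.+ z) (≡.sym (var^-⊛-≥ (suc m) (belowSeries c (suc m) (suc j)) k)))

  belowSeries≈gf : ∀ c m → M ≤ m → belowSeries c m (c m) ≈ gf c
  belowSeries≈gf c m M≤m = agree λ n n<M → go n (ℕ.≤-trans (ℕ.<⇒≤ n<M) M≤m)
    where
    go : ∀ n → n ≤ m → belowSeries c m (c m) n ≡ + #partitions c n
    go n n≤m = ≡.trans (≡.cong (λ m → belowSeries c m (c m) n) (≡.sym (ℕ.m∸n+n≡m n≤m))) (belowSeries-stable c (m ∸ n) n)

-- The three generating functions and their coefficients

colouring-periodic : ∀ t rs m → colouring t rs (t ℕ.+ m) ≡ colouring t rs m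
colouring-periodic t []             m = ≡.refl
colouring-periodic t ((a , k) ∷ rs) m = ≡.cong₂ ℕ._+_
  (≡.cong (λ b → if b then k else 0) (does-⇔ (mk⇔
    (λ p → ∣m+n∣m⇒∣n (≡.subst (+ t ∣_) e p) ∣-refl)
    (λ p → ≡.subst (+ t ∣_) (≡.sym e) (∣m∣n⇒∣m+n ∣-refl p)))
    (+ t ∣? (+ (t ℕ.+ m) - a)) (+ t ∣? (+ m - a))))
  (colouring-periodic t rs m)
  where
  e : + (t ℕ.+ m) - a ≡ + t ℤ.+ (+ m - a)
  e = ℤ.+-assoc (+ t) (+ m) (ℤ.- a)

module _ (M : ℕ) where
  open CommutativeRing (truncatedSeries M)
  open ListProducts (truncatedSeries M)
  open ProductIdentity (truncatedSeries M) var M using (Q)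
  open Truncated M

  -- The 2M blocks of 76 sizes reach at least to M, and larger parts do not touch the coefficients
  -- below q^M. The product with bounded sizes therefore already inverts the full generating
  -- function.
  gf-product : ∀ rs → ∏ᴸ Q (colouredSizes (colouring 76 rs) 76) * gf (colouring 76 rs) ≈ 1#
  gf-product rs = trans (*-congˡ (sym (belowSeries≈gf c (M ℕ.* 2 ℕ.* 76) M≤)))
    (P-periodic (belowSeries-counts c) 76 (M ℕ.* 2) (colouring-periodic 76 rs))
    where
    c : Colouring
    c = colouring 76 rs
    M≤ : M ≤ M ℕ.* 2 ℕ.* 76
    M≤ = ℕ.≤-trans (ℕ.m≤m*n M 2) (ℕ.m≤m*n (M ℕ.* 2) 76)

  gf-relation : (λ n → + K₁ n) ≈ var ^ 18 * (λ n → + K₂ n) + (λ n → + K₃ n)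
  gf-relation = Reciprocals.reciprocals (truncatedSeries M) var M var^M≈0
    (gf-product (± 1 2 ++ ± 18 1 ++ ± 20 1 ++ ± 38 2))
    (gf-product (± 18 1 ++ ± 20 1 ++ ± 37 2 ++ ± 38 2))
    (gf-product (± 1 2 ++ ± 19 2 ++ ± 37 2))
    -- Partitions into multiples of 76 supply the inverse of (q^76; q^76)_∞.
    (gf-product ((+ 0 , 1) ∷ []))

shifted-relation : ∀ (a b c : ℕ → ℕ) d →
  (∀ M → let open Truncated M in (λ n → + a n) ≈[ M ] (var ^ d) ⊛ (λ n → + b n) ⊕ (λ n → + c n)) →
  ∀ n → d ≤ n → + a n - + b (n ∸ d) - + c n ≡ 0ℤ
shifted-relation a b c d h n d≤n with k , ≡.refl ← ℕ.m≤n⇒∃[o]m+o≡n d≤n = begin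
  + a (d ℕ.+ k) - + b (d ℕ.+ k ∸ d) - + c (d ℕ.+ k)
    ≡⟨ ≡.cong₂ (λ x y → x - + b y - + c (d ℕ.+ k)) (coefficient (h M) (d ℕ.+ k) (ℕ.n<1+n _)) (ℕ.m+n∸m≡n d k) ⟩
  (var ^ d ⊛ (λ n → + b n)) (d ℕ.+ k) ℤ.+ + c (d ℕ.+ k) - + b k - + c (d ℕ.+ k)
    ≡⟨ ≡.cong (λ z → z ℤ.+ + c (d ℕ.+ k) - + b k - + c (d ℕ.+ k)) (var^-⊛-≥ d (λ n → + b n) k) ⟩
  + b k ℤ.+ + c (d ℕ.+ k) - + b k - + c (d ℕ.+ k)
    ≡⟨ cancel (+ b k) (+ c (d ℕ.+ k)) ⟩
  0ℤ ∎
  where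
  open ≡.≡-Reasoning
  M : ℕ
  -- Agreement is strict below M, so this is the least precision that shows the coefficient at d +
  -- k.
  M = suc (d ℕ.+ k)
  open Truncated M
  cancel : ∀ a b → a ℤ.+ b - a - b ≡ 0ℤ
  cancel = ℤ-solve-∀

theorem5p1 : ∀ (n : ℕ) → 18 ≤ n → + K₁ n - + K₂ (n ∸ 18) - + K₃ n ≡ 0ℤ
theorem5p1 = shifted-relation K₁ K₂ K₃ 18 gf-relation
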